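{- There is a polynomial-time algorithm which, given a hypergraph $H$ of rank 2 (i.e. all of whose edges have at most 2 vertices), computes the outcome $o(H)\in\{\mathcal{A},\mathcal{SL},\mathcal{E}\}$ of the Avoider-Enforcer game on $H$.
   Context: A hypergraph $H$ has a finite vertex set $V(H)$ and an edge set $E(H)\subseteq 2^{V(H)}$ (the empty edge is allowed). In the Avoider-Enforcer game on $H$, two players, Avoider and Enforcer, alternately pick one previously unpicked vertex of $H$ until all vertices have been picked. Enforcer wins if at the end Avoider has picked all the vertices of some edge of $H$; otherwise Avoider wins (in particular Enforcer wins if $\varnothing\in E(H)$). The last player is the player who makes the last move of the game: this is the first player if $|V(H)|$ is odd and the second player if $|V(H)|$ is even; the other player is the second-to-last player. A player "wins on $H$ as last (resp. second-to-last) player" if that player has a winning strategy when they are the last (resp. second-to-last) player. The outcome $o(H)$ is: $\mathcal{A}$ if Avoider wins on $H$ both as last player and as second-to-last player; $\mathcal{E}$ if Enforcer wins on $H$ both as last player and as second-to-last player; $\mathcal{SL}$ if whichever player is second-to-last wins. These are the only three possibilities. -}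

module Defs where

open import Data.Nat.Base using (ℕ; suc; _+_; _*_; _^_; _≤_; parity)
open import Data.Parity.Base using (Parity; 0ℙ; 1ℙ)
open import Data.Fin.Base using (Fin)
open import Data.Fin.Subset using (Subset; Side; inside; outside; _∈_; ∣_∣)
open import Data.List.Base as List using (List)
open import Data.List.Relation.Unary.All using (All)
open import Data.List.Relation.Unary.Any using (Any)
open import Data.Maybe.Base using (Maybe; just; nothing)
open import Data.Product.Base using (Σ-syntax; ∃-syntax; _×_)
open import Data.Vec.Base as Vec using (Vec; []; _∷_; lookup; replicate; _[_]≔_)
open import Relation.Binary.PropositionalEquality using (_≡_)
open import Relation.Nullary using (¬_)

-- The vertex set is Fin order.  The edge set is given by a listing, which
-- may include ∅; its order and repetitions do not affect the game, and an
-- algorithm has to handle every listing.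

record Hypergraph : Set where
  constructor hypergraph
  field
    order : ℕ
    edges : List (Subset order)

open Hypergraph public

HasRank2 : Hypergraph → Set
HasRank2 H = All (λ e → ∣ e ∣ ≤ 2) (edges H)

data Player : Set where
  avoider enforcer : Player

opponent : Player → Player
opponent avoider  = enforcer
opponent enforcer = avoider

-- Who has picked each vertex, if anyone.

Position : Hypergraph → Set
Position H = Vec (Maybe Player) (order H)

module _ (H : Hypergraph) where

  start : Position H
  start = replicate (order H) nothing

  Unpicked : Position H → Fin (order H) → Set
  Unpicked b v = lookup b v ≡ nothing

  Finished : Position H → Set
  Finished b = ∀ v → ¬ Unpicked b v

  pick : Player → Fin (order H) → Position H → Position H
  pick Q v b = b [ v ]≔ just Q

  HasWon : Player → Position H → Set
  HasWon enforcer b = Any (λ e → ∀ v → v ∈ e → lookup b v ≡ just avoider) (edges H)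
  HasWon avoider  b = ¬ HasWon enforcer b

  -- WinningStrategy P Q b: the winning strategies of P from position b
  -- with Q to move, as well-founded trees.

  data WinningStrategy (P : Player) : Player → Position H → Set where
    finished : ∀ {Q b} → Finished b → HasWon P b → WinningStrategy P Q b
    move     : ∀ {b} (v : Fin (order H)) → Unpicked b v →
               WinningStrategy P (opponent P) (pick P v b) →
               WinningStrategy P P b
    respond  : ∀ {b} → ¬ Finished b →
               (∀ v → Unpicked b v → WinningStrategy P P (pick (opponent P) v b)) →
               WinningStrategy P (opponent P) b

  -- The player who must move first for the given player to be last.

  firstIfLast : Player → Player
  firstIfLast last with parity (order H)
  ... | 1ℙ = last
  ... | 0ℙ = opponent last

  WinsAsLast : Player → Set
  WinsAsLast P = WinningStrategy P (firstIfLast P) start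

  WinsAsSecondToLast : Player → Set
  WinsAsSecondToLast P = WinningStrategy P (firstIfLast (opponent P)) start

data Outcome : Set where
  𝒜 𝒮ℒ ℰ : Outcome

HasOutcome : Hypergraph → Outcome → Set
HasOutcome H 𝒜  = WinsAsLast H avoider × WinsAsSecondToLast H avoider
HasOutcome H ℰ  = WinsAsLast H enforcer × WinsAsSecondToLast H enforcer
HasOutcome H 𝒮ℒ = WinsAsSecondToLast H avoider × WinsAsSecondToLast H enforcer

-- Model of computation.
--
-- A first-order, call-by-value functional language over binary trees, the
-- running time being the number of evaluation rules applied.  For a fixed
-- program each rule is a bounded number of pointer operations: trees are
-- only built one node at a time, shared, and inspected at the root (there
-- is no equality test and no arithmetic).  Hence a run of t steps is
-- simulated by a Turing machine in time polynomial in t and the input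
-- size; conversely a Turing machine, its tape held as two lists, is
-- simulated with constant overhead per step.  So polynomial time here is
-- the usual polynomial time.

infixr 5 _∙_

data Tree : Set where
  nil : Tree
  _∙_ : Tree → Tree → Tree

size : Tree → ℕ
size nil     = 1
size (x ∙ y) = suc (size x + size y)

-- Expressions over k functions of the given arities, with n variables in
-- scope (de Bruijn indices).  The second branch of a case binds the head
-- (variable 0) and the tail (variable 1) of the scrutinee.

data Expr {k : ℕ} (arity : Vec ℕ k) (n : ℕ) : Set where
  var     : Fin n → Expr arity n
  nil     : Expr arity n
  cons    : Expr arity n → Expr arity n → Expr arity n
  caseOf  : Expr arity n → Expr arity n → Expr arity (2 + n) → Expr arity n
  letIn   : Expr arity n → Expr arity (1 + n) → Expr arity n
  call    : (f : Fin k) → Vec (Expr arity n) (lookup arity f) → Expr arity n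

-- A finite table of mutually recursive functions and a main expression,
-- whose only variable is the input.

record Program : Set where
  field
    count : ℕ
    arity : Vec ℕ count
    body  : (f : Fin count) → Expr arity (lookup arity f)
    main  : Expr arity 1

module _ (p : Program) where
  open Program p

  infix 4 _⊢_⇓_after_ _⊢*_⇓_after_

  mutual
    -- ρ ⊢ e ⇓ v after t: in environment ρ, e evaluates to v in exactly
    -- t steps.

    data _⊢_⇓_after_ {n : ℕ} (ρ : Vec Tree n) : Expr arity n → Tree → ℕ → Set where
      var     : ∀ {i} → ρ ⊢ var i ⇓ lookup ρ i after 1
      nil     : ρ ⊢ nil ⇓ nil after 1
      cons    : ∀ {a b x y s t} →
                ρ ⊢ a ⇓ x after s → ρ ⊢ b ⇓ y after t →
                ρ ⊢ cons a b ⇓ x ∙ y after suc (s + t)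
      caseNil : ∀ {e a b v s t} →
                ρ ⊢ e ⇓ nil after s → ρ ⊢ a ⇓ v after t →
                ρ ⊢ caseOf e a b ⇓ v after suc (s + t)
      caseCons : ∀ {e a b x y v s t} →
                ρ ⊢ e ⇓ x ∙ y after s → (x ∷ y ∷ ρ) ⊢ b ⇓ v after t →
                ρ ⊢ caseOf e a b ⇓ v after suc (s + t)
      letIn   : ∀ {a b x v s t} →
                ρ ⊢ a ⇓ x after s → (x ∷ ρ) ⊢ b ⇓ v after t →
                ρ ⊢ letIn a b ⇓ v after suc (s + t)
      call    : ∀ {f as xs v s t} →
                ρ ⊢* as ⇓ xs after s → xs ⊢ body f ⇓ v after t →
                ρ ⊢ call f as ⇓ v after suc (s + t)

    data _⊢*_⇓_after_ {n : ℕ} (ρ : Vec Tree n) :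
           ∀ {m} → Vec (Expr arity n) m → Vec Tree m → ℕ → Set where
      []  : ρ ⊢* [] ⇓ [] after 0
      _∷_ : ∀ {m a x s t} {as : Vec (Expr arity n) m} {xs} →
            ρ ⊢ a ⇓ x after s → ρ ⊢* as ⇓ xs after t →
            ρ ⊢* (a ∷ as) ⇓ (x ∷ xs) after (s + t)

  RunsTo : Tree → Tree → ℕ → Set
  RunsTo x y t = (x ∷ []) ⊢ main ⇓ y after t

-- A relation R between instances satisfying Dom and answers is computed
-- by one fixed program, in time O(s^d) in the size s of the encoded input.
-- (Shared output trees could unfold to exponential size, so this is the
-- usual notion when encoded answers have polynomial size; those below have
-- bounded size.)

PolyTimeComputable : {A B : Set} → (A → Tree) → (B → Tree) →
                     (A → Set) → (A → B → Set) → Set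
PolyTimeComputable {A} {B} encodeIn encodeOut Dom R =
  Σ[ p ∈ Program ] ∃[ c ] ∃[ d ] ∀ (a : A) → Dom a →
    Σ[ b ∈ B ] ∃[ t ] R a b
      × RunsTo p (encodeIn a) (encodeOut b) t
      × t ≤ c * size (encodeIn a) ^ d + c

encodeList : List Tree → Tree
encodeList = List.foldr _∙_ nil

encodeSide : Side → Tree
encodeSide outside = nil
encodeSide inside  = nil ∙ nil

encodeSubset : ∀ {n} → Subset n → Tree
encodeSubset e = encodeList (Vec.toList (Vec.map encodeSide e))

-- The number of vertices in unary, then the incidence vectors of the edges.

encodeHypergraph : Hypergraph → Tree
encodeHypergraph H =
  encodeList (List.replicate (order H) nil) ∙ encodeList (List.map encodeSubset (edges H))

encodeOutcome : Outcome → Tree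
encodeOutcome 𝒜  = nil
encodeOutcome 𝒮ℒ = nil ∙ nil
encodeOutcome ℰ  = nil ∙ nil ∙ nil

{-# OPTIONS --safe #-}
module Submission where

-- Call a vertex spoiled if Avoider would complete an edge by picking it.  On the unpicked vertices the
-- edges of size 2 form a graph, and Avoider spoils the neighbours of every vertex she picks.  A defect is
-- a spoiled vertex or a path on three vertices.
--
-- If Avoider is last, she wins iff there is no defect: then an odd number of unpicked vertices always
-- includes an isolated one, which is safe to pick.  If she is second-to-last, she wins iff there is no bad
-- set: a nonempty even set without isolated vertices that keeps a defect when any one vertex is deleted.
-- Enforcer plays outside a bad set until Avoider has to pick inside it, which leaves a smaller bad set.
-- Without bad sets, Avoider picks an isolated vertex or a leaf whose neighbour meets all defects.
--
-- A minimal bad set has at most 12 vertices, so both criteria are first-order properties.  They are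
-- decided by an interpreter for first-order formulas, which takes polynomial time on any fixed formula.

open import Data.Bool.Base using (Bool; _∧_; _∨_; false; not; true)
open import Data.Bool.Properties using (not-involutive; ∧-idem)
open import Data.Empty using (⊥; ⊥-elim)
open import Data.Fin using (#_)
open import Data.Fin.Base as Fin using (Fin; suc; toℕ; zero)
import Data.Fin.Properties as Fin
open import Data.Fin.Relation.Unary.Top using (view; ‵fromℕ; ‵inject₁)
open import Data.Fin.Subset as Subset using (Subset; inside; outside; ∣_∣)
import Data.Fin.Subset.Properties as Subset
open import Data.List.Base as List
  using (List; []; _++_; _ʳ++_; _∷_; allFin; deduplicate; filter; length; reverse)
open import Data.List.Membership.DecPropositional using () renaming (_∈?_ to member?)
open import Data.List.Membership.Propositional using (_∈_; _∉_; find; lose)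
open import Data.List.Membership.Propositional.Properties
  using (∈-++⁺ʳ; ∈-++⁺ˡ; ∈-++⁻; ∈-allFin; ∈-deduplicate⁺; ∈-deduplicate⁻; ∈-filter⁺; ∈-filter⁻; ∈-map⁺; ∈-∃++)
open import Data.List.Properties
  using (length-++; length-deduplicate; length-reverse; length-tabulate; map-cong; map-∘; reverse-involutive)
open import Data.List.Relation.Unary.All as All using (All; []; _∷_)
open import Data.List.Relation.Unary.AllPairs as AllPairs using ([]; _∷_)
open import Data.List.Relation.Unary.Any as Any using (Any; here; there)
open import Data.List.Relation.Unary.Unique.DecPropositional.Properties using (deduplicate-!)
open import Data.List.Relation.Unary.Unique.Propositional using (Unique)
import Data.List.Relation.Unary.Unique.Propositional.Properties as Unique
open import Data.Maybe.Base using (Maybe; just; nothing)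
open import Data.Nat.Base
open import Data.Nat.Properties
open import Data.Nat.Tactic.RingSolver using (solve-∀)
open import Data.Parity.Base as Parity using (0ℙ; 1ℙ; Parity)
open import Data.Parity.Properties as Parity using (p≢p⁻¹; suc-homo-⁻¹; ⁻¹-injective)
open import Data.Product.Base using (_,_; _×_; proj₁; proj₂; ∃-syntax)
open import Data.Sum.Base using ([_,_]′; _⊎_; inj₁; inj₂)
open import Data.Vec.Base using (Vec; []; _∷_; lookup)
open import Data.Vec.Properties using (lookup-replicate; lookup∘update; lookup∘update′)
open import Defs
open import Function.Base using (_∘_; case_of_; id)
open import Relation.Binary.PropositionalEquality
open import Relation.Nullary
open import Relation.Nullary.Decidable using (_×-dec_; _⊎-dec_; decidable-stable; ¬?)

-- Finite sets as lists

-- Parity gives Enforcer a free move: the set to be protected has the parity that the number of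
-- unpicked vertices has at Avoider's turns, so at Enforcer's turns some unpicked vertex lies
-- outside it. If Avoider is last, the protected set is odd, and it is enough that each of its
-- vertices is spoiled or has a neighbour in it (a `Trap`), because the one vertex spoiled by
-- Avoider's pick is again such a set. If Avoider is second-to-last, the set is even and one spoiled
-- vertex is too little: a second odd piece that avoids this vertex must survive. The condition on
-- deletions in a bad set provides that piece. Avoider needs an invariant that survives the moves of
-- both players and follows from the failure of a formula. Hence `Sparse` excludes only bad sets of
-- at most 12 vertices. A large bad set comes up only in the search for a move, and `small-bad`
-- reduces it to a small one.

Finset : ℕ → Set
Finset n = List (Fin n)

_∈?_ : ∀ {n} (x : Fin n) (S : Finset n) → Dec (x ∈ S)
_∈?_ = member? Fin._≟_

infix 4 _⊆_
_⊆_ : ∀ {A : Set} → List A → List A → Set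
S ⊆ T = ∀ {x} → x ∈ S → x ∈ T

unique-∉ : ∀ {A : Set} {x : A} {S} → Unique (x ∷ S) → x ∉ S
unique-∉ (x∉ ∷ _) x∈S = All.lookup x∉ x∈S refl

∉-unique : ∀ {A : Set} {x : A} {S} → x ∉ S → Unique S → Unique (x ∷ S)
∉-unique x∉S u = All.tabulate (λ y∈S x≡y → x∉S (subst (_∈ _) (sym x≡y) y∈S)) ∷ u

unique-length : ∀ {A : Set} {S T : List A} → Unique S → S ⊆ T → length S ≤ length T
unique-length {S = []}    _ _ = z≤n
unique-length {S = x ∷ S} u S⊆T with ∈-∃++ (S⊆T (here refl))
... | as , bs , refl = begin
  suc (length S)                 ≤⟨ s≤s (unique-length (AllPairs.tail u) S⊆) ⟩
  suc (length (as ++ bs))        ≡⟨ cong suc (length-++ as) ⟩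
  suc (length as + length bs)    ≡⟨ +-suc (length as) (length bs) ⟨
  length as + suc (length bs)    ≡⟨ length-++ as ⟨
  length (as ++ x ∷ bs)          ∎
  where
  open ≤-Reasoning
  S⊆ : S ⊆ as ++ bs
  S⊆ y∈S with ∈-++⁻ as (S⊆T (there y∈S))
  ... | inj₁ y∈as          = ∈-++⁺ˡ y∈as
  ... | inj₂ (here refl)   = ⊥-elim (unique-∉ u y∈S)
  ... | inj₂ (there y∈bs)  = ∈-++⁺ʳ as y∈bs

unique-length-≡ : ∀ {A : Set} {S T : List A} → Unique S → Unique T → S ⊆ T → T ⊆ S → length S ≡ length T
unique-length-≡ u v S⊆T T⊆S = ≤-antisym (unique-length u S⊆T) (unique-length v T⊆S)

module _ {n : ℕ} where

  infixl 6 _∖_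
  abstract
    _∖_ : Finset n → Finset n → Finset n
    S ∖ T = filter (λ x → ¬? (x ∈? T)) S

    ∈-∖⁺ : ∀ {S T x} → x ∈ S → x ∉ T → x ∈ S ∖ T
    ∈-∖⁺ = ∈-filter⁺ _

    ∈-∖⁻ : ∀ {S T x} → x ∈ S ∖ T → x ∈ S × x ∉ T
    ∈-∖⁻ = ∈-filter⁻ _

    ∖-unique : ∀ {S} T → Unique S → Unique (S ∖ T)
    ∖-unique T = Unique.filter⁺ _

  ∖-⊆ : ∀ S {T} → S ∖ T ⊆ S
  ∖-⊆ S x∈ = proj₁ (∈-∖⁻ {S} x∈)

  ∖-mono : ∀ {S T U} → S ⊆ T → S ∖ U ⊆ T ∖ U
  ∖-mono {S} S⊆T x∈ = let x∈S , x∉U = ∈-∖⁻ {S} x∈ in ∈-∖⁺ (S⊆T x∈S) x∉U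

  ++-unique : ∀ {S T : Finset n} → Unique S → Unique T → (∀ {x} → x ∈ S → x ∉ T) → Unique (S ++ T)
  ++-unique u v disjoint = Unique.++⁺ u v (λ (x∈S , x∈T) → disjoint x∈S x∈T)

  ∖-length : ∀ {S T} → Unique S → Unique T → T ⊆ S → length T + length (S ∖ T) ≡ length S
  ∖-length {S} {T} u v T⊆S = trans (sym (length-++ T)) (unique-length-≡
    (++-unique v (∖-unique T u) (λ x∈T x∈ → proj₂ (∈-∖⁻ {S} x∈) x∈T)) u
    (λ x∈ → [ T⊆S , ∖-⊆ S ]′ (∈-++⁻ T x∈))
    (λ {x} x∈S → case x ∈? T of λ where
      (yes x∈T) → ∈-++⁺ˡ x∈T
      (no x∉T)  → ∈-++⁺ʳ T (∈-∖⁺ x∈S x∉T)))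

  -- The source of Enforcer's free move: the lengths will differ because their parities do.
  extra : ∀ {S T : Finset n} → Unique S → Unique T → T ⊆ S → length S ≢ length T → ∃[ x ] x ∈ S × x ∉ T
  extra {S} {T} u v T⊆S ≢ with Any.any? (λ x → ¬? (x ∈? T)) S
  ... | yes some = find some
  ... | no none  = ⊥-elim (≢ (unique-length-≡ u v
    (λ {x} x∈S → decidable-stable (x ∈? T) (λ x∉T → none (lose x∈S x∉T))) T⊆S))

-- Defects and bad sets

odd-pred : ∀ m k {p} → parity (m + k) ≡ p → parity m ≡ 1ℙ → parity k ≡ p Parity.⁻¹
odd-pred m k refl odd = trans (sym (Parity.⁻¹-involutive (parity k)))
  (cong Parity._⁻¹ (sym (trans (Parity.+-homo-+ m k) (cong (Parity._+ parity k) odd))))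

parity-suc : ∀ k → parity (suc k) ≡ parity k Parity.⁻¹
parity-suc k = ⁻¹-injective (trans (suc-homo-⁻¹ k) (sym (Parity.⁻¹-involutive (parity k))))

module Adjacency
  {n : ℕ} {R : Fin n → Fin n → Set} (R? : ∀ x y → Dec (R x y)) (R-sym : ∀ {x y} → R x y → R y x)
  where

  data Defect (L : Fin n → Set) (S : Finset n) : Set where
    loop : ∀ {x} → x ∈ S → L x → Defect L S
    path : ∀ {x y z} → x ∈ S → y ∈ S → z ∈ S → x ≢ y → y ≢ z → x ≢ z → R x y → R y z → Defect L S

  Covered : (Fin n → Set) → Finset n → Set
  Covered L S = ∀ {x} → x ∈ S → L x ⊎ ∃[ y ] y ∈ S × x ≢ y × R x y

  Robust : (Fin n → Set) → Finset n → Set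
  Robust L S = ∀ {u} → u ∈ S → Defect L (S ∖ List.[ u ])

  record Bad (L : Fin n → Set) (S : Finset n) : Set where
    field
      unique   : Unique S
      even     : parity (length S) ≡ 0ℙ
      nonempty : ∃[ x ] x ∈ S
      covered  : Covered L S
      robust   : Robust L S

  -- The vertices of a single defect, one or three of them. Being odd, one core is a trap, and two
  -- disjoint cores together form an even set.
  record Core (L : Fin n → Set) (V S : Finset n) : Set where
    field
      within  : S ⊆ V
      unique  : Unique S
      odd     : parity (length S) ≡ 1ℙ
      small   : length S ≤ 3
      covered : Covered L S
      defect  : Defect L S

  Isolated : Finset n → Fin n → Set
  Isolated S v = ∀ {y} → y ∈ S → v ≢ y → ¬ R v y

  defect-map : ∀ {L L′ S T} → S ⊆ T → (∀ {x} → x ∈ S → L x → L′ x) → Defect L S → Defect L′ T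
  defect-map S⊆T L⇒L′ (loop x∈S Lx) = loop (S⊆T x∈S) (L⇒L′ x∈S Lx)
  defect-map S⊆T L⇒L′ (path x∈S y∈S z∈S x≢y y≢z x≢z Rxy Ryz) =
    path (S⊆T x∈S) (S⊆T y∈S) (S⊆T z∈S) x≢y y≢z x≢z Rxy Ryz

  defect-mono : ∀ {L S T} → S ⊆ T → Defect L S → Defect L T
  defect-mono S⊆T = defect-map S⊆T (λ _ Lx → Lx)

  bad-map : ∀ {L L′ S} → (∀ {x} → x ∈ S → L x → L′ x) → Bad L S → Bad L′ S
  bad-map {S = S} L⇒L′ bad = record
    { unique   = unique
    ; even     = even
    ; nonempty = nonempty
    ; covered  = λ x∈S → case covered x∈S of λ where
        (inj₁ Lx)  → inj₁ (L⇒L′ x∈S Lx)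
        (inj₂ adj) → inj₂ adj
    ; robust   = λ u∈S → defect-map id (L⇒L′ ∘ ∖-⊆ S) (robust u∈S)
    }
    where open Bad bad

  covered-≈ : ∀ {L S T} → S ⊆ T → T ⊆ S → Covered L S → Covered L T
  covered-≈ S⊆T T⊆S cov x∈T with cov (T⊆S x∈T)
  ... | inj₁ Lx              = inj₁ Lx
  ... | inj₂ (y , y∈S , adj) = inj₂ (y , S⊆T y∈S , adj)

  covered-++ : ∀ {L S T} → Covered L S → Covered L T → Covered L (S ++ T)
  covered-++ {S = S} {T} cov cov′ x∈ with ∈-++⁻ S x∈
  ... | inj₁ x∈S = [ inj₁ , (λ (y , y∈ , adj) → inj₂ (y , ∈-++⁺ˡ y∈ , adj)) ]′ (cov x∈S)
  ... | inj₂ x∈T = [ inj₁ , (λ (y , y∈ , adj) → inj₂ (y , ∈-++⁺ʳ S y∈ , adj)) ]′ (cov′ x∈T)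

  ⊆-∖[] : ∀ {S T : Finset n} {u} → S ⊆ T → u ∉ S → S ⊆ T ∖ List.[ u ]
  ⊆-∖[] S⊆T u∉S x∈S = ∈-∖⁺ (S⊆T x∈S) λ where (here refl) → u∉S x∈S

  ∉-∖[] : ∀ {S T : Finset n} {u} → T ⊆ S ∖ List.[ u ] → u ∉ T
  ∉-∖[] {S} T⊆ u∈T = proj₂ (∈-∖⁻ {S = S} (T⊆ u∈T)) (here refl)

  core : ∀ {L V} → Defect L V → ∃[ S ] Core L V S
  core (loop {x} x∈V Lx) = List.[ x ] , record
    { within  = λ where (here refl) → x∈V
    ; unique  = [] ∷ []
    ; odd     = refl
    ; small   = s≤s z≤n
    ; covered = λ where (here refl) → inj₁ Lx
    ; defect  = loop (here refl) Lx
    }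
  core (path {x} {y} {z} x∈V y∈V z∈V x≢y y≢z x≢z Rxy Ryz) = x ∷ y ∷ z ∷ [] , record
    { within  = λ where
        (here refl)                 → x∈V
        (there (here refl))         → y∈V
        (there (there (here refl))) → z∈V
    ; unique  = (x≢y ∷ x≢z ∷ []) ∷ (y≢z ∷ []) ∷ [] ∷ []
    ; odd     = refl
    ; small   = ≤-refl
    ; covered = λ where
        (here refl)                 → inj₂ (y , there (here refl) , x≢y , Rxy)
        (there (here refl))         → inj₂ (x , here refl , x≢y ∘ sym , R-sym Rxy)
        (there (there (here refl))) → inj₂ (y , there (here refl) , y≢z ∘ sym , R-sym Ryz)
    ; defect  = path (here refl) (there (here refl)) (there (there (here refl))) x≢y y≢z x≢z Rxy Ryz
    }

  -- Without paths on three vertices the graph is a matching, which cannot cover an odd set. The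
  -- recursion removes a matched pair; a vertex isolated in the rest is not adjacent to the pair
  -- either, since that would complete a path.
  isolated-vertex : ∀ {L V} → Unique V → parity (length V) ≡ 1ℙ → ¬ Defect L V → ∃[ v ] v ∈ V × Isolated V v
  isolated-vertex {L} {V} = go (length V) ≤-refl
    where
    go : ∀ m {V} → length V ≤ m → Unique V → parity (length V) ≡ 1ℙ → ¬ Defect L V → ∃[ v ] v ∈ V × Isolated V v
    go (suc m) {x ∷ V} (s≤s V≤m) u odd ¬defect with Any.any? (R? x) V
    ... | no none = x , here refl , λ where
      (here refl)  x≢x _   → x≢x refl
      (there y∈V)  _   Rxy → none (lose y∈V Rxy)
    ... | yes some = v , W⊆V v∈W , λ {z} z∈ v≢z Rvz → case z ∈? (x ∷ y ∷ []) of λ where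
        (no z∉)                   → isolated (∈-∖⁺ z∈ z∉) v≢z Rvz
        (yes (here refl))         → ¬defect (path (W⊆V v∈W) (here refl) (there y∈V) v≢z x≢y v≢y Rvz Rxy)
        (yes (there (here refl))) →
          ¬defect (path (W⊆V v∈W) (there y∈V) (here refl) v≢z (x≢y ∘ sym) v≢x Rvz (R-sym Rxy))
      where
      y = proj₁ (find some)
      y∈V = proj₁ (proj₂ (find some))
      Rxy = proj₂ (proj₂ (find some))
      x≢y : x ≢ y
      x≢y x≡y = unique-∉ u (subst (_∈ V) (sym x≡y) y∈V)
      W = (x ∷ V) ∖ (x ∷ y ∷ [])
      W⊆V : W ⊆ x ∷ V
      W⊆V = ∖-⊆ (x ∷ V)
      sizes : 2 + length W ≡ suc (length V)
      sizes = ∖-length u ((x≢y ∷ []) ∷ [] ∷ []) λ where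
        (here refl)         → here refl
        (there (here refl)) → there y∈V
      inner = go m (≤-trans (n≤1+n _) (≤-trans (≤-reflexive (suc-injective sizes)) V≤m)) (∖-unique _ u)
        (trans (cong parity sizes) odd) (¬defect ∘ defect-mono W⊆V)
      v = proj₁ inner
      v∈W = proj₁ (proj₂ inner)
      isolated = proj₂ (proj₂ inner)
      v∉ = proj₂ (∈-∖⁻ {S = x ∷ V} v∈W)
      v≢x : v ≢ x
      v≢x v≡x = v∉ (here v≡x)
      v≢y : v ≢ y
      v≢y v≡y = v∉ (there (here v≡y))

  module _ {L : Fin n → Set} (L? : ∀ x → Dec (L x)) where

    isolated? : ∀ S v → Dec (Isolated S v)
    isolated? S v with Any.any? (λ y → ¬? (v Fin.≟ y) ×-dec R? v y) S
    ... | yes some = no λ isolated → let y , y∈S , v≢y , Rvy = find some in isolated y∈S v≢y Rvy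
    ... | no none  = yes λ y∈S v≢y Rvy → none (lose y∈S (v≢y , Rvy))

    defect? : ∀ S → Dec (Defect L S)
    defect? S with Any.any? L? S
                 | Any.any? (λ x → Any.any? (λ y → Any.any? (λ z →
                     ¬? (x Fin.≟ y) ×-dec ¬? (y Fin.≟ z) ×-dec ¬? (x Fin.≟ z) ×-dec R? x y ×-dec R? y z) S) S) S
    ... | yes some | _ = let x , x∈S , Lx = find some in yes (loop x∈S Lx)
    ... | no _     | yes some =
      let x , x∈S , some-y = find some
          y , y∈S , some-z = find some-y
          z , z∈S , x≢y , y≢z , x≢z , Rxy , Ryz = find some-z
      in yes (path x∈S y∈S z∈S x≢y y≢z x≢z Rxy Ryz)
    ... | no none  | no none′ = no λ where
      (loop x∈S Lx) → none (lose x∈S Lx)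
      (path x∈S y∈S z∈S x≢y y≢z x≢z Rxy Ryz) →
        none′ (lose x∈S (lose y∈S (lose z∈S (x≢y , y≢z , x≢z , Rxy , Ryz))))

    -- For each `x` in `D` one witness of robustness is enough, a core within `V` without `x`. The
    -- union of these cores is `U`, which has at most three vertices for each element of `D`.
    avoiding-cores : ∀ {V} → Robust L V → ∀ D → D ⊆ V →
      ∃[ U ] U ⊆ V × Covered L U × length U ≤ length D * 3 × (∀ {x} → x ∈ D → Defect L (U ∖ List.[ x ]))
    avoiding-cores robust []      _   = [] , (λ ()) , (λ ()) , z≤n , λ ()
    avoiding-cores {V} robust (x ∷ D) D⊆V
        with avoiding-cores robust D (D⊆V ∘ there) | core (robust (D⊆V (here refl)))
    ... | U , U⊆V , covered , short , avoids | S , c = S ++ U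
        , (λ y∈ → [ ∖-⊆ V ∘ within , U⊆V ]′ (∈-++⁻ S y∈))
        , covered-++ (Core.covered c) covered
        , ≤-trans (≤-reflexive (length-++ S)) (+-mono-≤ small short)
        , λ where
            (here refl) → defect-mono (⊆-∖[] ∈-++⁺ˡ (∉-∖[] {V} within)) defect
            (there y∈D) → defect-mono (∖-mono (∈-++⁺ʳ S)) (avoids y∈D)
      where open Core c hiding (covered)

    -- A defect D together with defects avoiding each vertex of D is robust; it has at most 3 + 3 * 3
    -- vertices, and if their number is odd then, V being even, one more vertex can be added.
    small-bad : ∀ {V} → Bad L V → ∃[ S ] S ⊆ V × length S ≤ 12 × Bad L S
    small-bad {V} bad with core (robust (proj₂ nonempty))
      where open Bad bad
    ... | D , c with avoiding-cores (Bad.robust bad) D D⊆V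
      where
      D⊆V : D ⊆ V
      D⊆V = ∖-⊆ V ∘ Core.within c
    ... | U′ , U′⊆V , covered′ , short , avoids = extend
      where
      open Bad bad
      D⊆V : D ⊆ V
      D⊆V = ∖-⊆ V ∘ Core.within c
      U = deduplicate Fin._≟_ (D ++ U′)
      U-unique : Unique U
      U-unique = deduplicate-! Fin._≟_ (D ++ U′)
      to : D ++ U′ ⊆ U
      to = ∈-deduplicate⁺ Fin._≟_
      from : U ⊆ D ++ U′
      from = ∈-deduplicate⁻ Fin._≟_ (D ++ U′)
      D⊆U : D ⊆ U
      D⊆U = to ∘ ∈-++⁺ˡ
      U⊆V : U ⊆ V
      U⊆V x∈ = [ D⊆V , U′⊆V ]′ (∈-++⁻ D (from x∈))
      U-covered : Covered L U
      U-covered = covered-≈ to from (covered-++ (Core.covered c) covered′)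
      U-robust : Robust L U
      U-robust {u} u∈U with u ∈? D
      ... | yes u∈D = defect-mono (∖-mono (to ∘ ∈-++⁺ʳ D)) (avoids u∈D)
      ... | no u∉D  = defect-mono (⊆-∖[] D⊆U u∉D) (Core.defect c)
      U-nonempty : ∃[ x ] x ∈ U
      U-nonempty with Core.defect c
      ... | loop x∈D _             = _ , D⊆U x∈D
      ... | path x∈D _ _ _ _ _ _ _ = _ , D⊆U x∈D
      U-short : length U ≤ 12
      U-short = ≤-trans (length-deduplicate Fin._≟_ (D ++ U′)) (≤-trans (≤-reflexive (length-++ D))
        (+-mono-≤ (Core.small c) (≤-trans short (*-monoˡ-≤ 3 (Core.small c)))))

      with-vertex : parity (length U) ≡ 1ℙ → ∀ {w} → w ∈ V → w ∉ U → L w ⊎ Any (R w) U → Bad L (w ∷ U)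
      with-vertex odd {w} w∈V w∉U reason = record
        { unique   = ∉-unique w∉U U-unique
        ; even     = trans (parity-suc (length U)) (cong Parity._⁻¹ odd)
        ; nonempty = w , here refl
        ; covered  = λ where
            (here refl) → [ inj₁ , (λ some → let y , y∈U , Rwy = find some in
                            inj₂ (y , there y∈U , (λ w≡y → w∉U (subst (_∈ U) (sym w≡y) y∈U)) , Rwy)) ]′ reason
            (there x∈U) → [ inj₁ , (λ (y , y∈U , adj) → inj₂ (y , there y∈U , adj)) ]′ (U-covered x∈U)
        ; robust   = λ where
            (here refl) → defect-mono (⊆-∖[] (there ∘ D⊆U) (w∉U ∘ D⊆U)) (Core.defect c)
            (there u∈U) → defect-mono (∖-mono there) (U-robust u∈U)
        }

      with-core : ∀ {C} → Core L (V ∖ U) C → Bad L (D ++ C)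
      with-core {C} c′ = record
        { unique   = ++-unique (Core.unique c) (Core.unique c′) disjoint
        ; even     = trans (cong parity (length-++ D)) (trans (Parity.+-homo-+ (length D) (length C))
                       (cong₂ Parity._+_ (Core.odd c) (Core.odd c′)))
        ; nonempty = let x , x∈D = D-nonempty in x , ∈-++⁺ˡ x∈D
        ; covered  = covered-++ (Core.covered c) (Core.covered c′)
        ; robust   = λ {u} _ → case u ∈? D of λ where
            (yes u∈D) → defect-mono (⊆-∖[] (∈-++⁺ʳ D) (disjoint u∈D)) (Core.defect c′)
            (no u∉D)  → defect-mono (⊆-∖[] ∈-++⁺ˡ u∉D) (Core.defect c)
        }
        where
        disjoint : ∀ {x} → x ∈ D → x ∉ C
        disjoint x∈D x∈C = proj₂ (∈-∖⁻ {S = V} (Core.within c′ x∈C)) (D⊆U x∈D)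
        D-nonempty : ∃[ x ] x ∈ D
        D-nonempty with Core.defect c
        ... | loop x∈D _             = _ , x∈D
        ... | path x∈D _ _ _ _ _ _ _ = _ , x∈D

      extend : ∃[ S ] S ⊆ V × length S ≤ 12 × Bad L S
      extend with parity (length U) in eq
      ... | 0ℙ = U , U⊆V , U-short , record
        { unique = U-unique ; even = eq ; nonempty = U-nonempty ; covered = U-covered ; robust = U-robust }
      ... | 1ℙ with Any.any? (λ w → ¬? (w ∈? U) ×-dec (L? w ⊎-dec Any.any? (R? w) U)) V
      ... | yes some = let w , w∈V , w∉U , reason = find some in
        w ∷ U , (λ { (here refl) → w∈V ; (there x∈U) → U⊆V x∈U })
        -- An odd length is not 12, which leaves room for `w`.
        , ≤∧≢⇒< U-short (λ 12≡ → case trans (sym eq) (cong parity 12≡) of λ ())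
        , with-vertex eq w∈V w∉U reason
      -- A second defect outside `U` replaces the other vertices of `U`: no single deletion meets
      -- two disjoint cores.
      ... | no none with defect? (V ∖ U)
      ... | yes defect = let C , c′ = core defect in
        D ++ C , (λ x∈ → [ D⊆V , ∖-⊆ V ∘ Core.within c′ ]′ (∈-++⁻ D x∈))
        , ≤-trans (≤-reflexive (length-++ D)) (≤-trans (+-mono-≤ (Core.small c) (Core.small c′)) (m≤n+m 6 6))
        , with-core c′
      -- Now `V ∖ U` is odd and has no defect, so one of its vertices is isolated there. As `V` is
      -- covered, this vertex is in `L` or has a neighbour in `U`, so it could have served as `w`.
      ... | no ¬defect = ⊥-elim contradiction′
        where
        odd : parity (length (V ∖ U)) ≡ 1ℙ
        odd = odd-pred (length U) _ (trans (cong parity (∖-length unique U-unique U⊆V)) even) eq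
        contradiction′ : ⊥
        contradiction′ with isolated-vertex (∖-unique U unique) odd ¬defect
        ... | v , v∈ , isolated with ∈-∖⁻ {S = V} v∈
        ... | v∈V , v∉U with covered v∈V
        ... | inj₁ Lv = none (lose v∈V (v∉U , inj₁ Lv))
        ... | inj₂ (y , y∈V , v≢y , Rvy) with y ∈? U
        ... | yes y∈U = none (lose v∈V (v∉U , inj₂ (lose y∈U Rvy)))
        ... | no y∉U  = isolated (∈-∖⁺ y∈V y∉U) v≢y Rvy

  -- The bound 12 is the reach of the search formula. For decidable `L`, `small-bad` shows that bad
  -- subsets of every size are excluded as well.
  Sparse : (Fin n → Set) → Finset n → Set
  Sparse L V = ∀ {S} → S ⊆ V → length S ≤ 12 → ¬ Bad L S

  -- Effect of Avoider's moves on traps, bad sets and sparse sets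

  record Trap (L : Fin n → Set) (S : Finset n) : Set where
    field
      unique  : Unique S
      odd     : parity (length S) ≡ 1ℙ
      covered : Covered L S

  module _ {L L′ : Fin n → Set} (L⇒L′ : ∀ {x} → L x → L′ x) where

    trap-map : ∀ {S} → Trap L S → Trap L′ S
    trap-map trap = record
      { unique = unique ; odd = odd ; covered = λ x∈S → [ inj₁ ∘ L⇒L′ , inj₂ ]′ (covered x∈S) }
      where open Trap trap

    module _ {S v} (v∈S : v ∈ S) (¬Lv : ¬ L v) (R⇒L′ : ∀ {y} → R v y → L′ y) where

      -- An unspoiled vertex of a trap has a neighbour in it; the pick spoils that neighbour, and a
      -- single spoiled vertex is a trap.
      trap-shrinks : Trap L S → ∃[ T ] T ⊆ S ∖ List.[ v ] × Trap L′ T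
      trap-shrinks trap with Trap.covered trap v∈S
      ... | inj₁ Lv = ⊥-elim (¬Lv Lv)
      ... | inj₂ (y , y∈S , v≢y , Rvy) = List.[ y ]
          , (λ where (here refl) → ∈-∖⁺ y∈S λ where (here refl) → v≢y refl)
          , record { unique = [] ∷ [] ; odd = refl ; covered = λ where (here refl) → inj₁ (R⇒L′ Rvy) }

      -- A neighbour y of v becomes a loop; so does a second one, unless a defect avoiding y survives.
      bad-shrinks : Bad L S → ∃[ T ] T ⊆ S ∖ List.[ v ] × Bad L′ T
      bad-shrinks bad with Bad.covered bad v∈S
      ... | inj₁ Lv = ⊥-elim (¬Lv Lv)
      ... | inj₂ (y , y∈S , v≢y , Rvy) with core (Bad.robust bad y∈S)
      ... | C , c = result
        where
        open Core c
        C⊆S : C ⊆ S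
        C⊆S = ∖-⊆ S ∘ within
        y∉C : y ∉ C
        y∉C = ∉-∖[] {S} within
        other : ∀ {z} → z ∈ S → v ≢ z → z ∈ S ∖ List.[ v ]
        other z∈S v≢z = ∈-∖⁺ z∈S λ where (here refl) → v≢z refl

        two-loops : ∀ {z} → z ∈ C → R v z → Bad L′ (y ∷ z ∷ [])
        two-loops {z} z∈C Rvz = record
          { unique   = (y≢z ∷ []) ∷ [] ∷ []
          ; even     = refl
          ; nonempty = y , here refl
          ; covered  = λ where
              (here refl)         → inj₁ (R⇒L′ Rvy)
              (there (here refl)) → inj₁ (R⇒L′ Rvz)
          ; robust   = λ where
              (here refl)         → loop (∈-∖⁺ (there (here refl)) λ where (here refl) → y≢z refl) (R⇒L′ Rvz)
              (there (here refl)) → loop (∈-∖⁺ (here refl) λ where (here refl) → y≢z refl) (R⇒L′ Rvy)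
          }
          where
          y≢z : y ≢ z
          y≢z refl = y∉C z∈C

        loop-and-core : Bad L′ (y ∷ C)
        loop-and-core = record
          { unique   = ∉-unique y∉C unique
          ; even     = trans (parity-suc (length C)) (cong Parity._⁻¹ odd)
          ; nonempty = y , here refl
          ; covered  = λ where
              (here refl)  → inj₁ (R⇒L′ Rvy)
              (there x∈C) → [ inj₁ ∘ L⇒L′ , (λ (z , z∈C , adj) → inj₂ (z , there z∈C , adj)) ]′ (covered x∈C)
          ; robust   = λ where
              (here refl)  → defect-map (⊆-∖[] there y∉C) (λ _ → L⇒L′) defect
              (there u∈C) → loop (∈-∖⁺ (here refl) λ where (here refl) → y∉C u∈C) (R⇒L′ Rvy)
          }

        result : ∃[ T ] T ⊆ S ∖ List.[ v ] × Bad L′ T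
        result with v ∈? C
        ... | no v∉C = y ∷ C
          , (λ where
              (here refl)  → other y∈S v≢y
              (there x∈C) → other (C⊆S x∈C) (λ { refl → v∉C x∈C }))
          , loop-and-core
        ... | yes v∈C with covered v∈C
        ... | inj₁ Lv = ⊥-elim (¬Lv Lv)
        ... | inj₂ (z , z∈C , v≢z , Rvz) = y ∷ z ∷ []
          , (λ where
              (here refl)         → other y∈S v≢y
              (there (here refl)) → other (C⊆S z∈C) v≢z)
          , two-loops z∈C Rvz

  sparse-anti : ∀ {L L′ V W} → W ⊆ V → (∀ {x} → x ∈ W → L′ x → L x) → Sparse L V → Sparse L′ W
  sparse-anti W⊆V L′⇒L sparse S⊆W short bad = sparse (W⊆V ∘ S⊆W) short (bad-map (L′⇒L ∘ S⊆W) bad)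

  module _ {L : Fin n → Set} (L? : ∀ x → Dec (L x)) {V : Finset n} (unique : Unique V) where

    private
      rest⊆ : ∀ {v} → V ∖ List.[ v ] ⊆ V
      rest⊆ = ∖-⊆ V

      rest-≢ : ∀ {v x} → x ∈ V ∖ List.[ v ] → v ≢ x
      rest-≢ x∈ v≡x = proj₂ (∈-∖⁻ {S = V} x∈) (here (sym v≡x))

      unchanged : ∀ {L′ : Fin n → Set} {v} → Isolated V v → (∀ {y} → L′ y → L y ⊎ R v y) →
                  ∀ {x} → x ∈ V ∖ List.[ v ] → L′ x → L x
      unchanged isolated L′⇒ x∈ L′x with L′⇒ L′x
      ... | inj₁ Lx  = Lx
      ... | inj₂ Rvx = ⊥-elim (isolated (rest⊆ x∈) (rest-≢ x∈) Rvx)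

    -- An isolated vertex spoils nothing that remains, and it is not spoiled itself, since a spoiled
    -- vertex is a defect.
    defect-free-move : parity (length V) ≡ 1ℙ → ¬ Defect L V →
      ∃[ v ] v ∈ V × ¬ L v × (∀ {L′ : Fin n → Set} → (∀ {y} → L′ y → L y ⊎ R v y) → ¬ Defect L′ (V ∖ List.[ v ]))
    defect-free-move odd ¬defect with isolated-vertex unique odd ¬defect
    ... | v , v∈V , isolated = v , v∈V , ¬defect ∘ loop v∈V ,
      λ L′⇒ → ¬defect ∘ defect-map rest⊆ (unchanged isolated L′⇒)

    -- Without an isolated vertex, V is not robust: V ∖ [ u ] is free of defects for some u.  By parity
    -- it has an isolated vertex v, whose only neighbour in V is u.
    sparse-move : parity (length V) ≡ 0ℙ → ∃[ x ] x ∈ V → Sparse L V →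
      ∃[ v ] v ∈ V × ¬ L v × (∀ {L′ : Fin n → Set} → (∀ {y} → L′ y → L y ⊎ R v y) → Sparse L′ (V ∖ List.[ v ]))
    sparse-move even nonempty sparse with Any.any? (λ v → ¬? (L? v) ×-dec isolated? L? V v) V
    ... | yes some = let v , v∈V , ¬Lv , isolated = find some in
      v , v∈V , ¬Lv , λ L′⇒ → sparse-anti rest⊆ (unchanged isolated L′⇒) sparse
    ... | no none with Any.any? (λ u → ¬? (defect? L? (V ∖ List.[ u ]))) V
    -- Every vertex is in `L` or has a neighbour, and every deletion leaves a defect, so `V` itself
    -- would be bad.
    ... | no always = let S , S⊆V , short , bad = small-bad L? whole in ⊥-elim (sparse S⊆V short bad)
      where
      whole : Bad L V
      whole = record
        { unique = unique ; even = even ; nonempty = nonempty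
        ; covered = λ {x} x∈V → case L? x of λ where
            (yes Lx) → inj₁ Lx
            (no ¬Lx) → case Any.any? (λ y → ¬? (x Fin.≟ y) ×-dec R? x y) V of λ where
              (yes some)   → inj₂ (find some)
              (no alone)   → ⊥-elim (none (lose x∈V
                (¬Lx , λ y∈V x≢y Rxy → alone (lose y∈V (x≢y , Rxy)))))
        ; robust = λ {u} u∈V → decidable-stable (defect? L? (V ∖ List.[ u ])) (λ ¬d → always (lose u∈V ¬d))
        }
    ... | yes some with find some
    ... | u , u∈V , ¬defect with isolated-vertex (∖-unique List.[ u ] unique) odd ¬defect
      where
      odd : parity (length (V ∖ List.[ u ])) ≡ 1ℙ
      odd = odd-pred 1 (length (V ∖ List.[ u ]))
        (trans (cong parity (∖-length unique ([] ∷ []) λ { (here refl) → u∈V })) even) refl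
    ... | v , v∈ , isolated = v , rest⊆ v∈ , ¬defect ∘ loop v∈ , after
      where
      after : ∀ {L′ : Fin n → Set} → (∀ {y} → L′ y → L y ⊎ R v y) → Sparse L′ (V ∖ List.[ v ])
      -- Among the remaining vertices the pick can spoil only `u`. A defect of `S` without `u` would
      -- thus have been a defect of `V` without `u` before the move, and there is none.
      after {L′} L′⇒ {S} S⊆ _ bad = ¬defect (defect-map (∖-mono (rest⊆ ∘ S⊆))
          (λ x∈ L′x → let x∈S , x∉ = ∈-∖⁻ {S = S} x∈ in case L′⇒ L′x of λ where
            (inj₁ Lx)  → Lx
            (inj₂ Rvx) → ⊥-elim (isolated (∈-∖⁺ (rest⊆ (S⊆ x∈S)) x∉) (rest-≢ (S⊆ x∈S)) Rvx))
          (defect-without u))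
        where
        open Bad bad using (robust) renaming (nonempty to inhabited)
        defect-without : ∀ u → Defect L′ (S ∖ List.[ u ])
        defect-without u with u ∈? S
        ... | yes u∈S = robust u∈S
        ... | no u∉S  = defect-mono (⊆-∖[] (∖-⊆ S) (u∉S ∘ ∖-⊆ S)) (robust (proj₂ inhabited))

-- Strategies

isNothing? : ∀ {A : Set} (m : Maybe A) → Dec (m ≡ nothing)
isNothing? nothing  = yes refl
isNothing? (just _) = no λ ()

isAvoider? : (m : Maybe Player) → Dec (m ≡ just avoider)
isAvoider? nothing         = no λ ()
isAvoider? (just avoider)  = yes refl
isAvoider? (just enforcer) = no λ ()

module Play (H : Hypergraph) where

  n = order H

  abstract
    unpicked : Position H → Finset n
    unpicked b = filter (λ v → isNothing? (lookup b v)) (allFin n)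

    ∈-unpicked⁺ : ∀ {b v} → Unpicked H b v → v ∈ unpicked b
    ∈-unpicked⁺ = ∈-filter⁺ _ (∈-allFin _)

    ∈-unpicked⁻ : ∀ {b v} → v ∈ unpicked b → Unpicked H b v
    ∈-unpicked⁻ {b} v∈ = proj₂ (∈-filter⁻ (λ v → isNothing? (lookup b v)) {xs = allFin n} v∈)

    unpicked-unique : ∀ b → Unique (unpicked b)
    unpicked-unique b = Unique.filter⁺ _ (Unique.allFin⁺ n)

  module _ {b : Position H} {v : Fin n} (v-free : Unpicked H b v) (Q : Player) where

    unpicked-pick : unpicked (pick H Q v b) ⊆ unpicked b ∖ List.[ v ]
    unpicked-pick {x} x∈ with x Fin.≟ v
    ... | yes refl = case trans (sym (lookup∘update v b (just Q))) (∈-unpicked⁻ {pick H Q v b} x∈) of λ ()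
    ... | no x≢v   = ∈-∖⁺
      (∈-unpicked⁺ (trans (sym (lookup∘update′ x≢v b (just Q))) (∈-unpicked⁻ {pick H Q v b} x∈)))
      λ where (here x≡v) → x≢v x≡v

    pick-unpicked : unpicked b ∖ List.[ v ] ⊆ unpicked (pick H Q v b)
    pick-unpicked {x} x∈ = let x∈b , x∉ = ∈-∖⁻ {S = unpicked b} x∈ in
      ∈-unpicked⁺ (trans (lookup∘update′ (x∉ ∘ here) b (just Q)) (∈-unpicked⁻ {b} x∈b))

    unpicked-pick-length : suc (length (unpicked (pick H Q v b))) ≡ length (unpicked b)
    unpicked-pick-length = trans
      (cong suc (unique-length-≡ (unpicked-unique _) (∖-unique _ (unpicked-unique b)) unpicked-pick pick-unpicked))
      (∖-length (unpicked-unique b) ([] ∷ []) λ where (here refl) → ∈-unpicked⁺ v-free)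

    kept : ∀ {x P} → lookup b x ≡ just P → lookup (pick H Q v b) x ≡ just P
    kept {x} x-picked =
      trans (lookup∘update′ (λ { refl → case trans (sym v-free) x-picked of λ () }) b (just Q)) x-picked

  finished-or-free : ∀ b → (∃[ x ] x ∈ unpicked b) ⊎ Finished H b
  finished-or-free b with unpicked b in eq
  ... | []    = inj₂ λ v v-free → case subst (v ∈_) eq (∈-unpicked⁺ v-free) of λ ()
  ... | x ∷ _ = inj₁ (x , here refl)

  -- Wins are counted only in finished positions. A completed edge stays completed, so Enforcer
  -- plays arbitrarily to the end.
  won-persists : ∀ m Q {b} → length (unpicked b) ≡ m → HasWon H enforcer b → WinningStrategy H enforcer Q b
  won-persists m Q {b} size won with finished-or-free b
  ... | inj₂ done = finished done won
  won-persists (suc m) avoider {b} size won | inj₁ (x , x∈) =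
    respond (λ done → done x (∈-unpicked⁻ {b} x∈)) λ v v-free →
      won-persists m enforcer (suc-injective (trans (unpicked-pick-length {b} v-free avoider) size))
        (Any.map (λ full w w∈e → kept {b} v-free avoider (full w w∈e)) won)
  won-persists (suc m) enforcer {b} size won | inj₁ (x , x∈) =
    move x x-free
      (won-persists m avoider (suc-injective (trans (unpicked-pick-length {b} x-free enforcer) size))
        (Any.map (λ full w w∈e → kept {b} x-free enforcer (full w w∈e)) won))
    where x-free = ∈-unpicked⁻ {b} x∈
  won-persists zero _ {b} size won | inj₁ (x , x∈) with unpicked b
  won-persists zero _ () _ | inj₁ (x , x∈) | _ ∷ _

  -- A singleton edge makes its vertex adjacent to itself.
  Adjacent : Fin n → Fin n → Set
  Adjacent x y = Any (λ e → x Subset.∈ e × y Subset.∈ e × ∀ z → z Subset.∈ e → z ≡ x ⊎ z ≡ y) (edges H)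

  -- The case `v ≡ x` is that of a singleton edge, which Avoider completes with `x` alone.
  Spoiled : Position H → Fin n → Set
  Spoiled b x = ∃[ v ] Adjacent v x × (v ≡ x ⊎ lookup b v ≡ just avoider)

  spoiled-kept : ∀ {b v} → Unpicked H b v → ∀ Q {x} → Spoiled b x → Spoiled (pick H Q v b) x
  spoiled-kept v-free Q (w , adj , inj₁ w≡x) = w , adj , inj₁ w≡x
  spoiled-kept {b} v-free Q (w , adj , inj₂ a)    = w , adj , inj₂ (kept {b} v-free Q a)

  spoiled-new : ∀ {b v x} → Adjacent v x → Spoiled (pick H avoider v b) x
  spoiled-new {b} {v} adj = v , adj , inj₂ (lookup∘update v b (just avoider))

  spoiled-pick : ∀ {b v x} → Spoiled (pick H avoider v b) x → Spoiled b x ⊎ Adjacent v x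
  spoiled-pick (w , adj , inj₁ w≡x) = inj₁ (w , adj , inj₁ w≡x)
  spoiled-pick {b} {v} (w , adj , inj₂ a) with w Fin.≟ v
  ... | yes refl = inj₂ adj
  ... | no w≢v   = inj₁ (w , adj , inj₂ (trans (sym (lookup∘update′ w≢v b (just avoider))) a))

  spoiled-enforcer : ∀ {b v x} → Spoiled (pick H enforcer v b) x → Spoiled b x
  spoiled-enforcer (w , adj , inj₁ w≡x) = w , adj , inj₁ w≡x
  spoiled-enforcer {b} {v} (w , adj , inj₂ a) with w Fin.≟ v
  ... | yes refl = case trans (sym (lookup∘update v b (just enforcer))) a of λ ()
  ... | no w≢v   = w , adj , inj₂ (trans (sym (lookup∘update′ w≢v b (just enforcer))) a)

  adjacent? : ∀ x y → Dec (Adjacent x y)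
  adjacent? x y = Any.any? (λ e → x Subset.∈? e ×-dec y Subset.∈? e ×-dec
    Fin.all? (λ z → (z Subset.∈? e) →-dec (z Fin.≟ x ⊎-dec z Fin.≟ y))) (edges H)

  adjacent-sym : ∀ {x y} → Adjacent x y → Adjacent y x
  adjacent-sym = Any.map λ (x∈e , y∈e , only) → y∈e , x∈e , λ z z∈e → [ inj₂ , inj₁ ]′ (only z z∈e)

  spoiled? : ∀ b x → Dec (Spoiled b x)
  spoiled? b x = Fin.any? (λ v → adjacent? v x ×-dec (v Fin.≟ x ⊎-dec isAvoider? (lookup b v)))

  spoiled-loses : ∀ {b v} → Unpicked H b v → Spoiled b v → HasWon H enforcer (pick H avoider v b)
  spoiled-loses {b} {v} v-free (w , adj , w-taken) = Any.map (λ (w∈e , v∈e , only) z z∈e →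
    [ (λ { refl → [ (λ { refl → lookup∘update v b (just avoider) }) , kept {b} v-free avoider ]′ w-taken })
    , (λ { refl → lookup∘update v b (just avoider) }) ]′ (only z z∈e)) adj

  -- The parity of the number of unpicked vertices, given its parity p at Avoider's turns.
  parityAt : Parity → Player → Parity
  parityAt p avoider  = p
  parityAt p enforcer = p Parity.⁻¹

  parity-pred : ∀ m {p} → parity (suc m) ≡ p → parity m ≡ p Parity.⁻¹
  parity-pred m eq = trans (sym (suc-homo-⁻¹ m)) (cong Parity._⁻¹ eq)

  module EnforcerWins
    (T : (Fin n → Set) → Finset n → Set) (p : Parity)
    (T-unique : ∀ {L S} → T L S → Unique S)
    (T-parity : ∀ {L S} → T L S → parity (length S) ≡ p)
    (T-inhabited : ∀ {L S} → T L S → ∃[ x ] x ∈ S)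
    (T-map : ∀ {L L′ : Fin n → Set} → (∀ {x} → L x → L′ x) → ∀ {S} → T L S → T L′ S)
    (T-shrinks : ∀ {L L′ : Fin n → Set} → (∀ {x} → L x → L′ x) → ∀ {S v} → v ∈ S → ¬ L v →
                 (∀ {y} → Adjacent v y → L′ y) → T L S → ∃[ S′ ] S′ ⊆ S ∖ List.[ v ] × T L′ S′)
    where

    -- At Enforcer's turn the number of unpicked vertices differs in parity from `length S`, so a
    -- vertex outside `S` can be picked. When Avoider picks an unspoiled vertex of `S`, `T-shrinks`
    -- gives a new set. These sets are never empty, so the vertices cannot run out before Avoider
    -- picks a spoiled one.
    strategy : ∀ m Q {b S} → length (unpicked b) ≡ m → parity m ≡ parityAt p Q →
               S ⊆ unpicked b → T (Spoiled b) S → WinningStrategy H enforcer Q b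
    strategy zero Q {b} size _ S⊆ t with unpicked b | S⊆ (proj₂ (T-inhabited t))
    strategy zero Q () _ S⊆ t | _ ∷ _ | _
    strategy (suc m) enforcer {b} {S} size par S⊆ t =
      move v v-free (strategy m avoider size′ par′ S⊆′ (T-map (spoiled-kept {b} v-free enforcer) t))
      where
      lengths≢ : length (unpicked b) ≢ length S
      lengths≢ eq = p≢p⁻¹ p (trans (sym (T-parity t)) (trans (cong parity (trans (sym eq) size)) par))
      chosen = extra (unpicked-unique b) (T-unique t) S⊆ lengths≢
      v = proj₁ chosen
      v-free = ∈-unpicked⁻ {b} (proj₁ (proj₂ chosen))
      size′ = suc-injective (trans (unpicked-pick-length {b} v-free enforcer) size)
      par′ : parity m ≡ p
      par′ = trans (parity-pred m par) (Parity.⁻¹-involutive p)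
      S⊆′ : S ⊆ unpicked (pick H enforcer v b)
      S⊆′ x∈S = pick-unpicked {b} v-free enforcer (∈-∖⁺ (S⊆ x∈S) λ where (here refl) → proj₂ (proj₂ chosen) x∈S)
    strategy (suc m) avoider {b} {S} size par S⊆ t =
      respond (λ done → done _ (∈-unpicked⁻ {b} (S⊆ (proj₂ (T-inhabited t))))) reply
      where
      reply : ∀ v → Unpicked H b v → WinningStrategy H enforcer enforcer (pick H avoider v b)
      reply v v-free = continue
        where
        b′ = pick H avoider v b
        size′ : length (unpicked b′) ≡ m
        size′ = suc-injective (trans (unpicked-pick-length {b} v-free avoider) size)
        par′ = parity-pred m par
        ⊆-pick : ∀ {S′} → S′ ⊆ unpicked b ∖ List.[ v ] → S′ ⊆ unpicked b′
        ⊆-pick S′⊆ = pick-unpicked {b} v-free avoider ∘ S′⊆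
        continue : WinningStrategy H enforcer enforcer b′
        continue with v ∈? S | spoiled? b v
        ... | _       | yes spoiled = won-persists m enforcer size′ (spoiled-loses {b} v-free spoiled)
        ... | no v∉S  | no _ = strategy m enforcer size′ par′
          (⊆-pick λ x∈S → ∈-∖⁺ (S⊆ x∈S) λ where (here refl) → v∉S x∈S) (T-map (spoiled-kept {b} v-free avoider) t)
        ... | yes v∈S | no ¬spoiled
            with T-shrinks (spoiled-kept {b} v-free avoider) v∈S ¬spoiled (spoiled-new {b}) t
        ... | S′ , S′⊆ , t′ = strategy m enforcer size′ par′
          (⊆-pick λ x∈ → let x∈S , x∉ = ∈-∖⁻ {S = S} (S′⊆ x∈) in ∈-∖⁺ (S⊆ x∈S) x∉) t′

  module AvoiderWins
    (rank2 : HasRank2 H)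
    (N : (Fin n → Set) → Finset n → Set) (p : Parity)
    (N-anti : ∀ {L L′ V W} → W ⊆ V → (∀ {x} → x ∈ W → L′ x → L x) → N L V → N L′ W)
    (N-move : ∀ {L} → (∀ x → Dec (L x)) → ∀ {V} → Unique V → parity (length V) ≡ p → ∃[ x ] x ∈ V → N L V →
              ∃[ v ] v ∈ V × ¬ L v ×
                (∀ {L′ : Fin n → Set} → (∀ {y} → L′ y → L y ⊎ Adjacent v y) → N L′ (V ∖ List.[ v ])))
    where

    -- For a singleton edge `w` is `v` itself, in accordance with the loops of `Adjacent`.
    rank2-edge : ∀ {k} {e : Subset k} {v} → ∣ e ∣ ≤ 2 → v Subset.∈ e →
                 ∃[ w ] w Subset.∈ e × ∀ z → z Subset.∈ e → z ≡ w ⊎ z ≡ v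
    rank2-edge {e = e} {v} e≤2 v∈e with Fin.any? (λ w → w Subset.∈? e ×-dec ¬? (w Fin.≟ v))
    ... | no only-v = v , v∈e , λ z z∈e → inj₁ (decidable-stable (z Fin.≟ v) (λ z≢v → only-v (z , z∈e , z≢v)))
    ... | yes (w , w∈e , w≢v) = w , w∈e , only
      where
      only : ∀ z → z Subset.∈ e → z ≡ w ⊎ z ≡ v
      only z z∈e with z Fin.≟ w | z Fin.≟ v
      ... | yes z≡w | _       = inj₁ z≡w
      ... | no _    | yes z≡v = inj₂ z≡v
      ... | no z≢w  | no z≢v  = ⊥-elim (<⇒≱ three e≤2)
        where
        three : 2 < ∣ e ∣
        -- Removing `v`, `w` and `z` in turn lowers the size each time.
        three = ≤-trans (s≤s (≤-trans (s≤s (≤-trans (s≤s z≤n) (Subset.x∈p⇒∣p-x∣<∣p∣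
          (Subset.x∈p∧x≢y⇒x∈p-y (Subset.x∈p∧x≢y⇒x∈p-y z∈e z≢v) z≢w))))
          (Subset.x∈p⇒∣p-x∣<∣p∣ (Subset.x∈p∧x≢y⇒x∈p-y w∈e w≢v)))) (Subset.x∈p⇒∣p-x∣<∣p∣ v∈e)

    -- An edge completed by this pick contains `v`. By rank 2 it has at most one other vertex, which
    -- Avoider already holds, so `v` was spoiled.
    safe-pick : ∀ {b v} → Unpicked H b v → ¬ Spoiled b v →
                ¬ HasWon H enforcer b → ¬ HasWon H enforcer (pick H avoider v b)
    safe-pick {b} {v} v-free ¬spoiled ¬won won′ with find won′
    ... | e , e∈H , full with v Subset.∈? e
    ... | no v∉e = ¬won (lose e∈H λ w w∈e →
      trans (sym (lookup∘update′ (λ { refl → v∉e w∈e }) b (just avoider))) (full w w∈e))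
    ... | yes v∈e with rank2-edge (All.lookup rank2 e∈H) v∈e
    ... | w , w∈e , only with w Fin.≟ v
    ... | yes refl = ¬spoiled (v , lose e∈H (v∈e , v∈e , only) , inj₁ refl)
    ... | no w≢v   = ¬spoiled (w , lose e∈H (w∈e , v∈e , only)
      , inj₂ (trans (sym (lookup∘update′ w≢v b (just avoider))) (full w w∈e)))

    -- Enforcer's picks remove vertices and spoil none, so `N-anti` preserves the invariant;
    -- `N-move` chooses Avoider's picks.
    strategy : ∀ m Q {b} → length (unpicked b) ≡ m → parity m ≡ parityAt p Q →
               ¬ HasWon H enforcer b → N (Spoiled b) (unpicked b) → WinningStrategy H avoider Q b
    strategy m Q {b} size par ¬won sparse with finished-or-free b
    ... | inj₂ done = finished done ¬won
    strategy zero _ {b} size _ _ _ | inj₁ (x , x∈) with unpicked b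
    strategy zero _ () _ _ _ | inj₁ (x , x∈) | _ ∷ _
    strategy (suc m) enforcer {b} size par ¬won sparse | inj₁ (x , x∈) =
      respond (λ done → done x (∈-unpicked⁻ {b} x∈)) λ v v-free →
        strategy m avoider (suc-injective (trans (unpicked-pick-length {b} v-free enforcer) size))
          (trans (parity-pred m par) (Parity.⁻¹-involutive p))
          (λ won → ¬won (Any.map (λ full w w∈e → was-avoider v w (full w w∈e)) won))
          (N-anti (∖-⊆ (unpicked b) ∘ unpicked-pick {b} v-free enforcer) (λ _ → spoiled-enforcer {b}) sparse)
      where
      was-avoider : ∀ v w → lookup (pick H enforcer v b) w ≡ just avoider → lookup b w ≡ just avoider
      was-avoider v w a with w Fin.≟ v
      ... | yes refl = case trans (sym (lookup∘update v b (just enforcer))) a of λ ()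
      ... | no w≢v   = trans (sym (lookup∘update′ w≢v b (just enforcer))) a
    strategy (suc m) avoider {b} size par ¬won sparse | inj₁ x∈
        with N-move (spoiled? b) (unpicked-unique b) (trans (cong parity size) par) x∈ sparse
    ... | v , v∈ , ¬spoiled , after = move v v-free
      (strategy m enforcer
        (suc-injective (trans (unpicked-pick-length {b} v-free avoider) size)) (parity-pred m par)
        (safe-pick {b} v-free ¬spoiled ¬won)
        (N-anti (unpicked-pick {b} v-free avoider) (λ _ → id) (after (spoiled-pick {b}))))
      where v-free = ∈-unpicked⁻ {b} v∈

-- Formulas and their interpreter

data Sort : Set where
  vertex edge : Sort
  list        : Sort → Sort

Context : Set
Context = List Sort

infixr 6 _∧ᶠ_
infixr 5 _∨ᶠ_

-- Quantifiers range over lists stored in the environment, so all loops of the interpreter are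
-- bounded. With `push` a formula can assemble candidate sets.
data Formula (Γ : Context) : Set where
  _∈ᶠ_  : vertex ∈ Γ → edge ∈ Γ → Formula Γ
  _≡ᶠ_  : vertex ∈ Γ → vertex ∈ Γ → Formula Γ
  ¬ᶠ_   : Formula Γ → Formula Γ
  _∧ᶠ_  : Formula Γ → Formula Γ → Formula Γ
  _∨ᶠ_  : Formula Γ → Formula Γ → Formula Γ
  ∃ᶠ    : ∀ {s} → list s ∈ Γ → Formula (s ∷ Γ) → Formula Γ
  push  : ∀ {s} → s ∈ Γ → list s ∈ Γ → Formula (list s ∷ Γ) → Formula Γ

module _ (n : ℕ) where

  ⟦_⟧ˢ : Sort → Set
  ⟦ vertex ⟧ˢ = Fin n
  ⟦ edge ⟧ˢ   = Subset n
  ⟦ list s ⟧ˢ = List ⟦ s ⟧ˢ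

  Env : Context → Set
  Env = All ⟦_⟧ˢ

fetch : ∀ {n Γ s} → Env n Γ → s ∈ Γ → ⟦_⟧ˢ n s
fetch (v ∷ ρ) (here refl) = v
fetch (v ∷ ρ) (there x)   = fetch ρ x

module _ {n : ℕ} where

  ⟦_⟧ : ∀ {Γ} → Formula Γ → Env n Γ → Set
  ⟦ x ∈ᶠ e ⟧ ρ     = fetch ρ x Subset.∈ fetch ρ e
  ⟦ x ≡ᶠ y ⟧ ρ     = fetch ρ x ≡ fetch ρ y
  ⟦ ¬ᶠ φ ⟧ ρ       = ¬ ⟦ φ ⟧ ρ
  ⟦ φ ∧ᶠ ψ ⟧ ρ     = ⟦ φ ⟧ ρ × ⟦ ψ ⟧ ρ
  ⟦ φ ∨ᶠ ψ ⟧ ρ     = ⟦ φ ⟧ ρ ⊎ ⟦ ψ ⟧ ρ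
  ⟦ ∃ᶠ l φ ⟧ ρ     = Any (λ x → ⟦ φ ⟧ (x ∷ ρ)) (fetch ρ l)
  ⟦ push x l φ ⟧ ρ = ⟦ φ ⟧ ((fetch ρ x ∷ fetch ρ l) ∷ ρ)

numeral : ℕ → Tree
numeral zero    = nil
numeral (suc k) = nil ∙ numeral k

slot : ∀ {Γ : Context} {s} → s ∈ Γ → Tree
slot (here _)  = nil
slot (there x) = nil ∙ slot x

norCode : Tree → Tree → Tree
norCode a b = numeral 1 ∙ a ∙ b

-- The operand may be evaluated twice. For a fixed formula this costs only a constant factor.
negCode : Tree → Tree
negCode a = norCode a a

-- Membership and equality share one code: `probe` with a numeral reads an incidence vector at that
-- index and compares with another numeral. All connectives reduce to nor, which keeps the
-- interpreter at four tags.
code : ∀ {Γ} → Formula Γ → Tree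
code (x ∈ᶠ e)     = numeral 0 ∙ slot x ∙ slot e
code (x ≡ᶠ y)     = numeral 0 ∙ slot x ∙ slot y
code (¬ᶠ φ)       = negCode (code φ)
code (φ ∧ᶠ ψ)     = norCode (negCode (code φ)) (negCode (code ψ))
code (φ ∨ᶠ ψ)     = negCode (norCode (code φ) (code ψ))
code (∃ᶠ l φ)     = numeral 2 ∙ slot l ∙ code φ
code (push x l φ) = numeral 3 ∙ slot x ∙ slot l ∙ code φ

encodeSort : ∀ {n} s → ⟦_⟧ˢ n s → Tree
encodeSort vertex   x = numeral (toℕ x)
encodeSort edge     e = encodeSubset e
encodeSort (list s) l = encodeList (List.map (encodeSort s) l)

encodeEnv : ∀ {n Γ} → Env n Γ → Tree
encodeEnv []              = nil
encodeEnv (_∷_ {x = s} v ρ) = encodeSort s v ∙ encodeEnv ρ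

encodeBool : Bool → Tree
encodeBool false = nil
encodeBool true  = nil ∙ nil

arities : Vec ℕ 4
arities = 2 ∷ 3 ∷ 2 ∷ 1 ∷ []

pattern probeᶠ  = zero
pattern loopᶠ   = suc zero
pattern evalᶠ   = suc (suc zero)
pattern suffixᶠ = suc (suc (suc zero))

trueᵉ : ∀ {n} → Expr arities n
trueᵉ = cons nil nil

constant : ∀ {n} → Tree → Expr arities n
constant nil     = nil
constant (x ∙ y) = cons (constant x) (constant y)

-- A formula is coded as tag ∙ operands, with tags 0 (probe), 1 (nor), 2 (loop) and 3 (push).  An expression
-- in the cons branches of k nested cases sees the parameters of the function from index 2 * k on.
bodies : (f : Fin 4) → Expr arities (lookup arities f)
bodies probeᶠ =
  caseOf (var (# 0))
    (caseOf (var (# 1)) trueᵉ (var (# 0)))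
    (caseOf (var (# 3)) nil (call probeᶠ (var (# 3) ∷ var (# 1) ∷ [])))
bodies loopᶠ =
  caseOf (var (# 0)) nil
    (caseOf (call evalᶠ (var (# 3) ∷ cons (var (# 0)) (var (# 4)) ∷ []))
      (call loopᶠ (var (# 1) ∷ var (# 3) ∷ var (# 4) ∷ []))
      trueᵉ)
bodies evalᶠ =
  caseOf (var (# 0)) nil (caseOf (var (# 1)) nil (caseOf (var (# 2))
    (call probeᶠ (call probeᶠ (var (# 0) ∷ var (# 5) ∷ []) ∷
                  call probeᶠ (var (# 1) ∷ var (# 5) ∷ []) ∷ []))
    (caseOf (var (# 1))
      (caseOf (call evalᶠ (var (# 2) ∷ var (# 7) ∷ []))
        (caseOf (call evalᶠ (var (# 3) ∷ var (# 7) ∷ [])) trueᵉ nil)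
        nil)
      (caseOf (var (# 1))
        (call loopᶠ (call probeᶠ (var (# 4) ∷ var (# 9) ∷ []) ∷ var (# 5) ∷ var (# 9) ∷ []))
        (caseOf (var (# 7)) nil
          (call evalᶠ
            (var (# 1) ∷
             cons (cons (call probeᶠ (var (# 8) ∷ var (# 13) ∷ []))
                        (call probeᶠ (var (# 0) ∷ var (# 13) ∷ [])))
                  (var (# 13)) ∷ [])))))))
bodies suffixᶠ =
  caseOf (var (# 0)) nil (cons (var (# 1)) (call suffixᶠ (var (# 1) ∷ [])))

decisionProgram : Tree → Tree → Program
decisionProgram a b = record
  { count = 4
  ; arity = arities
  ; body  = bodies
  ; main  = caseOf (var (# 0)) nil
      (letIn (cons (call suffixᶠ (var (# 0) ∷ [])) (cons (var (# 1)) (cons nil nil)))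
        (caseOf (call evalᶠ (constant a ∷ var (# 0) ∷ [])) nil
          (caseOf (call evalᶠ (constant b ∷ var (# 2) ∷ []))
            (constant (encodeOutcome 𝒮ℒ)) (constant (encodeOutcome ℰ)))))
  }

module _ {n : ℕ} where

  ⟦_⟧? : ∀ {Γ} (φ : Formula Γ) (ρ : Env n Γ) → Dec (⟦ φ ⟧ ρ)
  ⟦ x ∈ᶠ e ⟧? ρ     = Subset._∈?_ (fetch ρ x) (fetch ρ e)
  ⟦ x ≡ᶠ y ⟧? ρ     = fetch ρ x Fin.≟ fetch ρ y
  ⟦ ¬ᶠ φ ⟧? ρ       = ¬? (⟦ φ ⟧? ρ)
  ⟦ φ ∧ᶠ ψ ⟧? ρ     = ⟦ φ ⟧? ρ ×-dec ⟦ ψ ⟧? ρ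
  ⟦ φ ∨ᶠ ψ ⟧? ρ     = ⟦ φ ⟧? ρ ⊎-dec ⟦ ψ ⟧? ρ
  ⟦ ∃ᶠ l φ ⟧? ρ     = Any.any? (λ x → ⟦ φ ⟧? (x ∷ ρ)) (fetch ρ l)
  ⟦ push x l φ ⟧? ρ = ⟦ φ ⟧? ((fetch ρ x ∷ fetch ρ l) ∷ ρ)

-- On numerals k: looks up the k-th entry of a list, and tests equality with another numeral (an entry of
-- which is nil, that is, false).
probe : Tree → Tree → Tree
probe nil     nil     = nil ∙ nil
probe nil     (h ∙ _) = h
probe (_ ∙ x) nil     = nil
probe (_ ∙ x) (_ ∙ y) = probe x y

suffixes : Tree → Tree
suffixes nil     = nil
suffixes (_ ∙ x) = x ∙ suffixes x

-- Here `M` bounds the size of the encoded environment. Extending the environment at most triples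
-- it: `push` adds copies of an element and of a list already stored there, each of size below `M`.
cost : ∀ {Γ} → Formula Γ → ℕ → ℕ
probeCost : Tree → Tree → ℕ → ℕ
norCost : ℕ → ℕ → ℕ

probeCost i j M = 13 + 7 * size i + 7 * size j + 7 * M
norCost A B = 19 + A + B

cost (x ∈ᶠ e)     M = probeCost (slot x) (slot e) M
cost (x ≡ᶠ y)     M = probeCost (slot x) (slot y) M
cost (¬ᶠ φ)       M = norCost (cost φ M) (cost φ M)
cost (φ ∧ᶠ ψ)     M = norCost (norCost (cost φ M) (cost φ M)) (norCost (cost ψ M) (cost ψ M))
cost (φ ∨ᶠ ψ)     M = norCost (norCost (cost φ M) (cost ψ M)) (norCost (cost φ M) (cost ψ M))
cost (∃ᶠ l φ)     M = 16 + 7 * size (slot l) + (14 + cost φ (3 * M)) * M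
cost (push x l φ) M = 23 + 7 * size (slot x) + 7 * size (slot l) + cost φ (3 * M)

private
  slack : ∀ {m k} d → m + d ≡ k → m ≤ k
  slack {m} d refl = m≤m+n m d

-- Correctness and running time of the interpreter

module Runs {a b : Tree} where

  private p = decisionProgram a b

  infix 4 _⊢_⇓_within_ _⊢*_⇓_within_
  -- Upper bounds instead of exact step counts, so that branches of different lengths can share one
  -- bound.
  _⊢_⇓_within_ : ∀ {n} → Vec Tree n → Expr arities n → Tree → ℕ → Set
  ρ ⊢ e ⇓ v within B = ∃[ t ] Defs._⊢_⇓_after_ p ρ e v t × t ≤ B

  _⊢*_⇓_within_ : ∀ {n m} → Vec Tree n → Vec (Expr arities n) m → Vec Tree m → ℕ → Set
  ρ ⊢* es ⇓ vs within B = ∃[ t ] Defs._⊢*_⇓_after_ p ρ es vs t × t ≤ B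

  module _ {n : ℕ} {ρ : Vec Tree n} where

    weaken : ∀ {e v A B} → A ≤ B → ρ ⊢ e ⇓ v within A → ρ ⊢ e ⇓ v within B
    weaken A≤B (t , d , t≤A) = t , d , ≤-trans t≤A A≤B

    recast : ∀ {e v w B} → v ≡ w → ρ ⊢ e ⇓ v within B → ρ ⊢ e ⇓ w within B
    recast refl r = r

    ⇓var : ∀ i → ρ ⊢ var i ⇓ lookup ρ i within 1
    ⇓var i = 1 , var , ≤-refl

    ⇓nil : ρ ⊢ nil ⇓ nil within 1
    ⇓nil = 1 , nil , ≤-refl

    ⇓cons : ∀ {e f x y A B} → ρ ⊢ e ⇓ x within A → ρ ⊢ f ⇓ y within B →
            ρ ⊢ cons e f ⇓ x ∙ y within suc (A + B)
    ⇓cons (_ , d , s≤A) (_ , d′ , t≤B) = _ , cons d d′ , s≤s (+-mono-≤ s≤A t≤B)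

    ⇓caseNil : ∀ {e f g v A B} → ρ ⊢ e ⇓ nil within A → ρ ⊢ f ⇓ v within B →
               ρ ⊢ caseOf e f g ⇓ v within suc (A + B)
    ⇓caseNil (_ , d , s≤A) (_ , d′ , t≤B) = _ , caseNil d d′ , s≤s (+-mono-≤ s≤A t≤B)

    ⇓caseCons : ∀ {e f g x y v A B} → ρ ⊢ e ⇓ x ∙ y within A →
                (x ∷ y ∷ ρ) ⊢ g ⇓ v within B →
                ρ ⊢ caseOf e f g ⇓ v within suc (A + B)
    ⇓caseCons (_ , d , s≤A) (_ , d′ , t≤B) = _ , caseCons d d′ , s≤s (+-mono-≤ s≤A t≤B)

    ⇓letIn : ∀ {e f x v A B} → ρ ⊢ e ⇓ x within A → (x ∷ ρ) ⊢ f ⇓ v within B →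
             ρ ⊢ letIn e f ⇓ v within suc (A + B)
    ⇓letIn (_ , d , s≤A) (_ , d′ , t≤B) = _ , letIn d d′ , s≤s (+-mono-≤ s≤A t≤B)

    ⇓call : ∀ {f es vs v A B} → ρ ⊢* es ⇓ vs within A → vs ⊢ bodies f ⇓ v within B →
            ρ ⊢ call f es ⇓ v within suc (A + B)
    ⇓call (_ , d , s≤A) (_ , d′ , t≤B) = _ , call d d′ , s≤s (+-mono-≤ s≤A t≤B)

    ⇓[] : ρ ⊢* [] ⇓ [] within 0
    ⇓[] = 0 , [] , ≤-refl

    infixr 5 _⇓∷_
    _⇓∷_ : ∀ {m e v} {es : Vec (Expr arities n) m} {vs A B} →
           ρ ⊢ e ⇓ v within A → ρ ⊢* es ⇓ vs within B → ρ ⊢* (e ∷ es) ⇓ (v ∷ vs) within (A + B)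
    (_ , d , s≤A) ⇓∷ (_ , d′ , t≤B) = _ , d ∷ d′ , +-mono-≤ s≤A t≤B

    ⇓true : ρ ⊢ trueᵉ ⇓ encodeBool true within 3
    ⇓true = ⇓cons ⇓nil ⇓nil

    ⇓constant : ∀ x → ρ ⊢ constant x ⇓ x within size x
    ⇓constant nil     = ⇓nil
    ⇓constant (x ∙ y) = ⇓cons (⇓constant x) (⇓constant y)

  ⇓probe : ∀ x y → (x ∷ y ∷ []) ⊢ bodies probeᶠ ⇓ probe x y within 7 * size x
  ⇓probe nil     nil     = ⇓caseNil (⇓var _) (⇓caseNil (⇓var _) ⇓true)
  ⇓probe nil     (h ∙ y) = weaken (m≤n+m 5 2) (⇓caseNil (⇓var _) (⇓caseCons (⇓var _) (⇓var _)))
  ⇓probe (w ∙ x) nil     = weaken (≤-trans (m≤n+m 5 2) (m≤m*n 7 (size (w ∙ x))))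
    (⇓caseCons (⇓var _) (⇓caseNil (⇓var _) ⇓nil))
  ⇓probe (w ∙ x) (h ∙ y) = weaken bound
    (⇓caseCons (⇓var _) (⇓caseCons (⇓var _) (⇓call (⇓var _ ⇓∷ ⇓var _ ⇓∷ ⇓[]) (⇓probe x y))))
    where
    bound : 7 + 7 * size x ≤ 7 * size (w ∙ x)
    bound = ≤-trans (≤-reflexive (sym (*-suc 7 (size x)))) (*-monoʳ-≤ 7 (s≤s (m≤n+m (size x) (size w))))

  ⇓suffixes : ∀ x → (x ∷ []) ⊢ bodies suffixᶠ ⇓ suffixes x within 6 * size x
  ⇓suffixes nil     = weaken (m≤n+m 3 3) (⇓caseNil (⇓var _) ⇓nil)
  ⇓suffixes (w ∙ x) = weaken bound
    (⇓caseCons (⇓var _) (⇓cons (⇓var _) (⇓call (⇓var _ ⇓∷ ⇓[]) (⇓suffixes x))))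
    where
    bound : 6 + 6 * size x ≤ 6 * size (w ∙ x)
    bound = ≤-trans (≤-reflexive (sym (*-suc 6 (size x)))) (*-monoʳ-≤ 6 (s≤s (m≤n+m (size x) (size w))))

  -- Stated for any decidable predicate with a known evaluation bound, so that the induction on the
  -- list is separate from the induction on formulas in `⇓eval`.
  ⇓loop : ∀ {A : Set} {P : A → Set} (P? : ∀ x → Dec (P x)) (enc : A → Tree) (c ρ : Tree) (B : ℕ) (l : List A) →
          (∀ x → x ∈ l → (c ∷ (enc x ∙ ρ) ∷ []) ⊢ bodies evalᶠ ⇓ encodeBool (does (P? x)) within B) →
          (encodeList (List.map enc l) ∷ c ∷ ρ ∷ []) ⊢ bodies loopᶠ ⇓ encodeBool (does (Any.any? P? l))
            within (14 + B) * size (encodeList (List.map enc l))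
  ⇓loop P? enc c ρ B []      runs =
    weaken (≤-trans (m≤m+n 3 (11 + B)) (m≤m*n (14 + B) 1)) (⇓caseNil (⇓var _) ⇓nil)
  ⇓loop P? enc c ρ B (x ∷ l) runs = weaken bound (⇓caseCons (⇓var _) scrutinise)
    where
    K = 14 + B
    L = size (encodeList (List.map enc l))
    test = runs x (here refl)
    scrutinise : (enc x ∷ encodeList (List.map enc l) ∷ _ ∷ c ∷ ρ ∷ []) ⊢ _ ⇓
      encodeBool (does (P? x) ∨ does (Any.any? P? l)) within suc (suc (4 + B) + suc (3 + K * L))
    scrutinise with does (P? x) | test
    ... | true  | r = weaken (s≤s (+-monoʳ-≤ (suc (4 + B)) (m≤m+n 3 _)))
                       (⇓caseCons (⇓call (⇓var _ ⇓∷ ⇓cons (⇓var _) (⇓var _) ⇓∷ ⇓[]) r) ⇓true)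
    ... | false | r = ⇓caseNil (⇓call (⇓var _ ⇓∷ ⇓cons (⇓var _) (⇓var _) ⇓∷ ⇓[]) r)
                       (⇓call (⇓var _ ⇓∷ ⇓var _ ⇓∷ ⇓var _ ⇓∷ ⇓[]) (⇓loop P? enc c ρ B l (λ y → runs y ∘ there)))
    bound : suc (1 + suc (suc (4 + B) + suc (3 + K * L))) ≤ K * size (enc x ∙ encodeList (List.map enc l))
    bound = begin
      suc (1 + suc (suc (4 + B) + suc (3 + K * L))) ≡⟨ regroup B (K * L) ⟩
      12 + B + K * L                                ≤⟨ m≤n+m _ 2 ⟩
      K + K * L                                     ≡⟨ *-suc K L ⟨
      K * suc L                                     ≤⟨ *-monoʳ-≤ K (s≤s (m≤n+m L (size (enc x)))) ⟩
      K * size (enc x ∙ encodeList (List.map enc l)) ∎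
      where
      open ≤-Reasoning
      regroup : ∀ b t → suc (1 + suc (suc (4 + b) + suc (3 + t))) ≡ 12 + b + t
      regroup = solve-∀

  private
    lookupSize : ∀ {n Γ s} (x : s ∈ Γ) (ρ : Env n Γ) → suc (size (encodeSort s (fetch ρ x))) ≤ size (encodeEnv ρ)
    lookupSize (here refl) (v ∷ ρ) = s≤s (m≤m+n _ _)
    lookupSize (there x)   (v ∷ ρ) = m≤n⇒m≤1+n (≤-trans (lookupSize x ρ) (m≤n+m _ _))

    probe-slot : ∀ {n Γ s} (x : s ∈ Γ) (ρ : Env n Γ) → probe (slot x) (encodeEnv ρ) ≡ encodeSort s (fetch ρ x)
    probe-slot (here refl) (v ∷ ρ) = refl
    probe-slot (there x)   (v ∷ ρ) = probe-slot x ρ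

    probe-∈ : ∀ {n} (x : Fin n) (e : Subset n) →
              probe (numeral (toℕ x)) (encodeSubset e) ≡ encodeBool (does (x Subset.∈? e))
    probe-∈ zero    (outside ∷ e) = refl
    probe-∈ zero    (inside ∷ e)  = refl
    probe-∈ (suc x) (s ∷ e)       = probe-∈ x e

    probe-≡ : ∀ {n} (x y : Fin n) → probe (numeral (toℕ x)) (numeral (toℕ y)) ≡ encodeBool (does (x Fin.≟ y))
    probe-≡ zero    zero    = refl
    probe-≡ zero    (suc y) = refl
    probe-≡ (suc x) zero    = refl
    probe-≡ (suc x) (suc y) = probe-≡ x y

  ⇓nor : ∀ {c d ρ A B x y} → (c ∷ ρ ∷ []) ⊢ bodies evalᶠ ⇓ encodeBool x within A →
         (d ∷ ρ ∷ []) ⊢ bodies evalᶠ ⇓ encodeBool y within B →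
         (norCode c d ∷ ρ ∷ []) ⊢ bodies evalᶠ ⇓ encodeBool (not x ∧ not y) within norCost A B
  ⇓nor {A = A} {B} {x = true} r s = weaken (slack (6 + B) (regroup A B))
    (⇓caseCons (⇓var _) (⇓caseCons (⇓var _) (⇓caseCons (⇓var _) (⇓caseNil (⇓var _)
    (⇓caseCons (⇓call (⇓var _ ⇓∷ ⇓var _ ⇓∷ ⇓[]) r) ⇓nil)))))
    where
    regroup : ∀ a b → 8 + suc (suc (2 + a) + 1) + (6 + b) ≡ 19 + a + b
    regroup = solve-∀
  ⇓nor {A = A} {B} {x = false} {true} r s = weaken (slack 2 (regroup A B))
    (⇓caseCons (⇓var _) (⇓caseCons (⇓var _) (⇓caseCons (⇓var _) (⇓caseNil (⇓var _)
    (⇓caseNil (⇓call (⇓var _ ⇓∷ ⇓var _ ⇓∷ ⇓[]) r) (⇓caseCons (⇓call (⇓var _ ⇓∷ ⇓var _ ⇓∷ ⇓[]) s) ⇓nil))))))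
    where
    regroup : ∀ a b → 8 + suc (suc (2 + a) + suc (suc (2 + b) + 1)) + 2 ≡ 19 + a + b
    regroup = solve-∀
  ⇓nor {A = A} {B} {x = false} {false} r s = weaken (≤-reflexive (regroup A B))
    (⇓caseCons (⇓var _) (⇓caseCons (⇓var _) (⇓caseCons (⇓var _) (⇓caseNil (⇓var _)
    (⇓caseNil (⇓call (⇓var _ ⇓∷ ⇓var _ ⇓∷ ⇓[]) r) (⇓caseNil (⇓call (⇓var _ ⇓∷ ⇓var _ ⇓∷ ⇓[]) s) ⇓true))))))
    where
    regroup : ∀ a b → 8 + suc (suc (2 + a) + suc (suc (2 + b) + 3)) ≡ 19 + a + b
    regroup = solve-∀

  ⇓neg : ∀ {c ρ A x} → (c ∷ ρ ∷ []) ⊢ bodies evalᶠ ⇓ encodeBool x within A →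
         (negCode c ∷ ρ ∷ []) ⊢ bodies evalᶠ ⇓ encodeBool (not x) within norCost A A
  ⇓neg r = recast (cong encodeBool (∧-idem _)) (⇓nor r r)

  ⇓atom : ∀ {n Γ s t} (x : s ∈ Γ) (y : t ∈ Γ) (ρ : Env n Γ) M → size (encodeEnv ρ) ≤ M →
    ((numeral 0 ∙ slot x ∙ slot y) ∷ encodeEnv ρ ∷ []) ⊢ bodies evalᶠ ⇓
      probe (encodeSort s (fetch ρ x)) (encodeSort t (fetch ρ y)) within probeCost (slot x) (slot y) M
  ⇓atom {s = s} x y ρ M ρ≤M rewrite sym (probe-slot x ρ) | sym (probe-slot y ρ) = weaken bound
    (⇓caseCons (⇓var _) (⇓caseCons (⇓var _) (⇓caseNil (⇓var _)
      (⇓call (⇓call (⇓var _ ⇓∷ ⇓var _ ⇓∷ ⇓[]) (⇓probe (slot x) (encodeEnv ρ)) ⇓∷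
              ⇓call (⇓var _ ⇓∷ ⇓var _ ⇓∷ ⇓[]) (⇓probe (slot y) (encodeEnv ρ)) ⇓∷ ⇓[])
             (⇓probe (probe (slot x) (encodeEnv ρ)) (probe (slot y) (encodeEnv ρ)))))))
    where
    X = probe (slot x) (encodeEnv ρ)
    -- The time of the outer probe depends only on its first argument, which is an entry of the
    -- environment.
    X≤M : size X ≤ M
    X≤M = ≤-trans (≤-trans (≤-reflexive (cong size (probe-slot x ρ))) (<⇒≤ (lookupSize x ρ))) ρ≤M
    regroup : ∀ i j z → 6 + suc ((suc (2 + 7 * i) + (suc (2 + 7 * j) + 0)) + z) ≡ 13 + 7 * i + 7 * j + z
    regroup = solve-∀
    bound : 6 + suc ((suc (2 + 7 * size (slot x)) + (suc (2 + 7 * size (slot y)) + 0)) + 7 * size X)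
            ≤ probeCost (slot x) (slot y) M
    bound = ≤-trans (≤-reflexive (regroup (size (slot x)) (size (slot y)) (7 * size X)))
                    (+-monoʳ-≤ (13 + 7 * size (slot x) + 7 * size (slot y)) (*-monoʳ-≤ 7 X≤M))

  ⇓∃ : ∀ {n Γ s} (l : list s ∈ Γ) (φ : Formula (s ∷ Γ)) (ρ : Env n Γ) M B → size (encodeEnv ρ) ≤ M →
    (∀ x → x ∈ fetch ρ l →
      (code φ ∷ encodeEnv (x ∷ ρ) ∷ []) ⊢ bodies evalᶠ ⇓ encodeBool (does (⟦ φ ⟧? (x ∷ ρ))) within B) →
    (code (∃ᶠ l φ) ∷ encodeEnv ρ ∷ []) ⊢ bodies evalᶠ ⇓ encodeBool (does (⟦ ∃ᶠ l φ ⟧? ρ))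
      within 16 + 7 * size (slot l) + (14 + B) * M
  ⇓∃ {s = s} l φ ρ M B ρ≤M runs =
    weaken bound (⇓caseCons (⇓var _) (⇓caseCons (⇓var _) (⇓caseCons (⇓var _) (⇓caseCons (⇓var _) (⇓caseNil (⇓var _)
      (⇓call (⇓call (⇓var _ ⇓∷ ⇓var _ ⇓∷ ⇓[]) (⇓probe (slot l) (encodeEnv ρ)) ⇓∷ ⇓var _ ⇓∷ ⇓var _ ⇓∷ ⇓[])
        loop))))))
    where
    L = size (encodeSort (list s) (fetch ρ l))
    loop : (probe (slot l) (encodeEnv ρ) ∷ code φ ∷ encodeEnv ρ ∷ []) ⊢ bodies loopᶠ ⇓
             encodeBool (does (⟦ ∃ᶠ l φ ⟧? ρ)) within (14 + B) * L
    loop rewrite probe-slot l ρ =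
      ⇓loop (λ x → ⟦ φ ⟧? (x ∷ ρ)) (encodeSort s) (code φ) (encodeEnv ρ) B (fetch ρ l) runs
    regroup : ∀ i z → 10 + suc ((suc (2 + 7 * i) + 2) + z) ≡ 16 + 7 * i + z
    regroup = solve-∀
    bound : 10 + suc ((suc (2 + 7 * size (slot l)) + 2) + (14 + B) * L) ≤ 16 + 7 * size (slot l) + (14 + B) * M
    bound = ≤-trans (≤-reflexive (regroup (size (slot l)) ((14 + B) * L)))
              (+-monoʳ-≤ (16 + 7 * size (slot l)) (*-monoʳ-≤ (14 + B) (≤-trans (<⇒≤ (lookupSize l ρ)) ρ≤M)))

  ⇓push : ∀ {n Γ s} (x : s ∈ Γ) (l : list s ∈ Γ) (φ : Formula (list s ∷ Γ)) (ρ : Env n Γ) B v →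
    (code φ ∷ encodeEnv {Γ = list s ∷ Γ} ((fetch ρ x ∷ fetch ρ l) ∷ ρ) ∷ []) ⊢ bodies evalᶠ ⇓ v within B →
    (code (push x l φ) ∷ encodeEnv ρ ∷ []) ⊢ bodies evalᶠ ⇓ v within 23 + 7 * size (slot x) + 7 * size (slot l) + B
  ⇓push x l φ ρ B v r rewrite sym (probe-slot x ρ) | sym (probe-slot l ρ) =
    weaken (≤-reflexive (regroup (size (slot x)) (size (slot l)) B))
      (⇓caseCons (⇓var _) (⇓caseCons (⇓var _) (⇓caseCons (⇓var _)
      (⇓caseCons (⇓var _) (⇓caseCons (⇓var _) (⇓caseCons (⇓var _)
        (⇓call (⇓var _ ⇓∷ ⇓cons (⇓cons (⇓call (⇓var _ ⇓∷ ⇓var _ ⇓∷ ⇓[]) (⇓probe (slot x) (encodeEnv ρ)))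
                                       (⇓call (⇓var _ ⇓∷ ⇓var _ ⇓∷ ⇓[]) (⇓probe (slot l) (encodeEnv ρ))))
                                (⇓var _) ⇓∷ ⇓[]) r)))))))
    where
    regroup : ∀ i j z → 12 + suc ((1 + (suc (suc (suc (2 + 7 * i) + suc (2 + 7 * j)) + 1) + 0)) + z)
              ≡ 23 + 7 * i + 7 * j + z
    regroup = solve-∀

  private
    ∨-by-nor : ∀ x y → not (not x ∧ not y) ≡ x ∨ y
    ∨-by-nor false y = not-involutive y
    ∨-by-nor true  y = refl

    elementSize : ∀ {n s} {x : ⟦_⟧ˢ n s} {l} → x ∈ l → suc (size (encodeSort s x)) ≤ size (encodeSort (list s) l)
    elementSize (here refl) = s≤s (m≤m+n _ _)
    elementSize (there x∈l) = m≤n⇒m≤1+n (≤-trans (elementSize x∈l) (m≤n+m _ _))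

    elementEnvSize : ∀ {n Γ s} (l : list s ∈ Γ) (ρ : Env n Γ) {M} → size (encodeEnv ρ) ≤ M → ∀ {x} → x ∈ fetch ρ l →
                     size (encodeEnv (x ∷ ρ)) ≤ 3 * M
    elementEnvSize l ρ {M} ρ≤M {x} x∈l = begin
      suc (size (encodeSort _ x)) + size (encodeEnv ρ) ≤⟨ +-mono-≤ x≤M ρ≤M ⟩
      M + M                                            ≤⟨ +-monoʳ-≤ M (m≤m+n M (M + 0)) ⟩
      3 * M                                            ∎
      where
      open ≤-Reasoning
      x≤M : suc (size (encodeSort _ x)) ≤ M
      x≤M = ≤-trans (elementSize x∈l) (≤-trans (<⇒≤ (lookupSize l ρ)) ρ≤M)

    pushEnvSize : ∀ {n Γ s} (x : s ∈ Γ) (l : list s ∈ Γ) (ρ : Env n Γ) {M} → size (encodeEnv ρ) ≤ M →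
                  size (encodeEnv {Γ = list s ∷ Γ} ((fetch ρ x ∷ fetch ρ l) ∷ ρ)) ≤ 3 * M
    pushEnvSize x l ρ {M} ρ≤M = begin
      suc (suc (X + L) + E)     ≡⟨ cong (λ k → suc (k + E)) (+-suc X L) ⟨
      (suc X + suc L) + E       ≡⟨ +-assoc (suc X) (suc L) E ⟩
      suc X + (suc L + E)       ≤⟨ +-mono-≤ (fits x) (+-mono-≤ (fits l) ρ≤M) ⟩
      M + (M + M)               ≡⟨ cong (λ k → M + (M + k)) (+-identityʳ M) ⟨
      3 * M                     ∎
      where
      open ≤-Reasoning
      X = size (encodeSort _ (fetch ρ x))
      L = size (encodeSort _ (fetch ρ l))
      E = size (encodeEnv ρ)
      fits : ∀ {t} (y : t ∈ _) → suc (size (encodeSort t (fetch ρ y))) ≤ M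
      fits y = ≤-trans (lookupSize y ρ) ρ≤M

  ⇓eval : ∀ {n Γ} (φ : Formula Γ) (ρ : Env n Γ) M → size (encodeEnv ρ) ≤ M →
          (code φ ∷ encodeEnv ρ ∷ []) ⊢ bodies evalᶠ ⇓ encodeBool (does (⟦ φ ⟧? ρ)) within cost φ M
  ⇓eval (x ∈ᶠ e) ρ M ρ≤M with ⇓atom x e ρ M ρ≤M
  ... | r rewrite probe-∈ (fetch ρ x) (fetch ρ e) = r
  ⇓eval (x ≡ᶠ y) ρ M ρ≤M with ⇓atom x y ρ M ρ≤M
  ... | r rewrite probe-≡ (fetch ρ x) (fetch ρ y) = r
  ⇓eval (¬ᶠ φ) ρ M ρ≤M = ⇓neg (⇓eval φ ρ M ρ≤M)
  ⇓eval (φ ∧ᶠ ψ) ρ M ρ≤M =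
    recast (cong encodeBool (cong₂ _∧_ (not-involutive (does (⟦ φ ⟧? ρ))) (not-involutive (does (⟦ ψ ⟧? ρ)))))
      (⇓nor (⇓neg (⇓eval φ ρ M ρ≤M)) (⇓neg (⇓eval ψ ρ M ρ≤M)))
  ⇓eval (φ ∨ᶠ ψ) ρ M ρ≤M =
    recast (cong encodeBool (∨-by-nor (does (⟦ φ ⟧? ρ)) (does (⟦ ψ ⟧? ρ))))
      (⇓neg (⇓nor (⇓eval φ ρ M ρ≤M) (⇓eval ψ ρ M ρ≤M)))
  ⇓eval (∃ᶠ l φ) ρ M ρ≤M = ⇓∃ l φ ρ M _ ρ≤M (λ x x∈l → ⇓eval φ (x ∷ ρ) (3 * M) (elementEnvSize l ρ ρ≤M x∈l))
  ⇓eval (push x l φ) ρ M ρ≤M = ⇓push x l φ ρ _ _ (⇓eval φ _ (3 * M) (pushEnvSize x l ρ ρ≤M))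

-- Polynomial time

-- One monomial in `suc m` is enough: as its base is at least 1, powers grow with the exponent, and
-- sums and products are absorbed by adding degrees.
record Polynomial (f : ℕ → ℕ) : Set where
  constructor polynomial
  field
    coefficient degree : ℕ
    bound              : ∀ m → f m ≤ coefficient * suc m ^ degree

*-^ : ∀ x y d → (x * y) ^ d ≡ x ^ d * y ^ d
*-^ x y zero    = refl
*-^ x y (suc d) = trans (cong (x * y *_) (*-^ x y d)) (regroup x y (x ^ d) (y ^ d))
  where
  regroup : ∀ x y a b → x * y * (a * b) ≡ x * a * (y * b)
  regroup = solve-∀

-- For `1 ≤ m` one has `suc m ≤ 2 * m`, whence the factor `2 ^ d`.
polynomial-bound : ∀ {f} → Polynomial f → ∃[ c ] ∃[ d ] ∀ m → 1 ≤ m → f m ≤ c * m ^ d + c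
polynomial-bound {f} (polynomial a d p) = a * 2 ^ d , d , λ m 1≤m → begin
  f m                       ≤⟨ p m ⟩
  a * suc m ^ d             ≤⟨ *-monoʳ-≤ a (^-monoˡ-≤ d (+-mono-≤ 1≤m (≤-reflexive (sym (+-identityʳ m))))) ⟩
  a * (2 * m) ^ d           ≡⟨ cong (a *_) (*-^ 2 m d) ⟩
  a * (2 ^ d * m ^ d)       ≡⟨ *-assoc a (2 ^ d) (m ^ d) ⟨
  a * 2 ^ d * m ^ d         ≤⟨ m≤m+n _ _ ⟩
  a * 2 ^ d * m ^ d + a * 2 ^ d ∎
  where open ≤-Reasoning

const-polynomial : ∀ k → Polynomial (λ _ → k)
const-polynomial k = polynomial k 0 (λ m → ≤-reflexive (sym (*-identityʳ k)))

id-polynomial : Polynomial (λ m → m)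
id-polynomial = polynomial 1 1 λ m →
  ≤-trans (n≤1+n m) (≤-reflexive (trans (sym (*-identityʳ (suc m))) (sym (*-identityˡ _))))

+-polynomial : ∀ {f g} → Polynomial f → Polynomial g → Polynomial (λ m → f m + g m)
+-polynomial {f} {g} (polynomial a d p) (polynomial b e q) = polynomial (a + b) (d + e) λ m → begin
  f m + g m                                         ≤⟨ +-mono-≤ (p m) (q m) ⟩
  a * suc m ^ d + b * suc m ^ e                     ≤⟨ +-mono-≤ (*-monoʳ-≤ a (^-monoʳ-≤ (suc m) (m≤m+n d e)))
                                                              (*-monoʳ-≤ b (^-monoʳ-≤ (suc m) (m≤n+m e d))) ⟩
  a * suc m ^ (d + e) + b * suc m ^ (d + e)         ≡⟨ *-distribʳ-+ (suc m ^ (d + e)) a b ⟨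
  (a + b) * suc m ^ (d + e)                         ∎
  where open ≤-Reasoning

*-polynomial : ∀ {f g} → Polynomial f → Polynomial g → Polynomial (λ m → f m * g m)
*-polynomial {f} {g} (polynomial a d p) (polynomial b e q) = polynomial (a * b) (d + e) λ m → begin
  f m * g m                         ≤⟨ *-mono-≤ (p m) (q m) ⟩
  a * suc m ^ d * (b * suc m ^ e)   ≡⟨ regroup a b (suc m ^ d) (suc m ^ e) ⟩
  a * b * (suc m ^ d * suc m ^ e)   ≡⟨ cong (a * b *_) (^-distribˡ-+-* (suc m) d e) ⟨
  a * b * suc m ^ (d + e)           ∎
  where
  open ≤-Reasoning
  regroup : ∀ a b x y → a * x * (b * y) ≡ a * b * (x * y)
  regroup = solve-∀

square-polynomial : ∀ {f} → Polynomial f → Polynomial (λ m → f (m * m))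
square-polynomial {f} (polynomial a d p) = polynomial a (d + d) λ m → begin
  f (m * m)                       ≤⟨ p (m * m) ⟩
  a * suc (m * m) ^ d             ≤⟨ *-monoʳ-≤ a (^-monoˡ-≤ d (s≤s (square m))) ⟩
  a * (suc m * suc m) ^ d         ≡⟨ cong (a *_) (*-^ (suc m) (suc m) d) ⟩
  a * (suc m ^ d * suc m ^ d)     ≡⟨ cong (a *_) (^-distribˡ-+-* (suc m) d d) ⟨
  a * suc m ^ (d + d)             ∎
  where
  open ≤-Reasoning
  square : ∀ m → m * m ≤ m + m * suc m
  square m = ≤-trans (*-monoʳ-≤ m (n≤1+n m)) (m≤n+m (m * suc m) m)

scale-polynomial : ∀ {f} → Polynomial f → Polynomial (λ m → f (3 * m))
scale-polynomial {f} (polynomial a d p) = polynomial (a * 3 ^ d) d λ m → begin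
  f (3 * m)                       ≤⟨ p (3 * m) ⟩
  a * suc (3 * m) ^ d             ≤⟨ *-monoʳ-≤ a (^-monoˡ-≤ d (triple m)) ⟩
  a * (3 * suc m) ^ d             ≡⟨ cong (a *_) (*-^ 3 (suc m) d) ⟩
  a * (3 ^ d * suc m ^ d)         ≡⟨ *-assoc a (3 ^ d) (suc m ^ d) ⟨
  a * 3 ^ d * suc m ^ d           ∎
  where
  open ≤-Reasoning
  triple : ∀ m → suc (3 * m) ≤ 3 * suc m
  triple m = ≤-trans (m≤n+m (suc (3 * m)) 2) (≤-reflexive (sym (*-suc 3 m)))

norCost-polynomial : ∀ {f g} → Polynomial f → Polynomial g → Polynomial (λ m → norCost (f m) (g m))
norCost-polynomial p q = +-polynomial (+-polynomial (const-polynomial 19) p) q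

cost-polynomial : ∀ {Γ} (φ : Formula Γ) → Polynomial (cost φ)
cost-polynomial (x ∈ᶠ e) = +-polynomial (const-polynomial (13 + 7 * size (slot x) + 7 * size (slot e)))
  (*-polynomial (const-polynomial 7) id-polynomial)
cost-polynomial (x ≡ᶠ y) = +-polynomial (const-polynomial (13 + 7 * size (slot x) + 7 * size (slot y)))
  (*-polynomial (const-polynomial 7) id-polynomial)
cost-polynomial (¬ᶠ φ) = norCost-polynomial (cost-polynomial φ) (cost-polynomial φ)
cost-polynomial (φ ∧ᶠ ψ) = norCost-polynomial
  (norCost-polynomial (cost-polynomial φ) (cost-polynomial φ))
  (norCost-polynomial (cost-polynomial ψ) (cost-polynomial ψ))
cost-polynomial (φ ∨ᶠ ψ) = norCost-polynomial
  (norCost-polynomial (cost-polynomial φ) (cost-polynomial ψ))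
  (norCost-polynomial (cost-polynomial φ) (cost-polynomial ψ))
cost-polynomial (∃ᶠ l φ) = +-polynomial (const-polynomial (16 + 7 * size (slot l)))
  (*-polynomial (+-polynomial (const-polynomial 14) (scale-polynomial (cost-polynomial φ))) id-polynomial)
cost-polynomial (push x l φ) = +-polynomial (const-polynomial (23 + 7 * size (slot x) + 7 * size (slot l)))
  (scale-polynomial (cost-polynomial φ))

-- In descending order, because the program obtains the vertices as the proper suffixes of the unary
-- numeral `n`, longest first.
vertices : ∀ n → List (Fin n)
vertices zero    = []
vertices (suc n) = Fin.fromℕ n ∷ List.map Fin.inject₁ (vertices n)

vertices-complete : ∀ {n} (x : Fin n) → x ∈ vertices n
vertices-complete {suc n} x with view x
... | ‵fromℕ     = here refl
... | ‵inject₁ y = there (∈-map⁺ Fin.inject₁ (vertices-complete y))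

-- The last list is empty. Formulas have no constant for the empty set, and `push` needs one to
-- start from.
Input : Context
Input = list vertex ∷ list edge ∷ list vertex ∷ []

input : ∀ H → Env (order H) Input
input H = vertices (order H) ∷ edges H ∷ [] ∷ []

-- The arguments say whether Avoider loses as last and as second-to-last player. By `last⇒`, not
-- losing as last player settles both.
outcomeOf : Bool → Bool → Outcome
outcomeOf false _     = 𝒜
outcomeOf true  false = 𝒮ℒ
outcomeOf true  true  = ℰ

private
  numeral-replicate : ∀ n → encodeList (List.replicate n nil) ≡ numeral n
  numeral-replicate zero    = refl
  numeral-replicate (suc n) = cong (nil ∙_) (numeral-replicate n)

  suffixes-numeral : ∀ n → suffixes (numeral n) ≡ encodeSort (list vertex) (vertices n)
  suffixes-numeral zero    = refl
  suffixes-numeral (suc n) = cong₂ _∙_ (cong numeral (sym (Fin.toℕ-fromℕ n)))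
    (trans (suffixes-numeral n) (cong encodeList
      (trans (map-cong (λ x → cong numeral (sym (Fin.toℕ-inject₁ x))) (vertices n)) (map-∘ (vertices n)))))

  suffixes-size : ∀ x → size (suffixes x) ≤ size x * size x
  suffixes-size nil     = ≤-refl
  suffixes-size (w ∙ x) = begin
    suc (X + size (suffixes x)) ≤⟨ s≤s (+-monoʳ-≤ X (suffixes-size x)) ⟩
    suc X + X * X               ≤⟨ +-monoʳ-≤ (suc X) (*-monoʳ-≤ X (n≤1+n X)) ⟩
    suc X * suc X               ≤⟨ *-mono-≤ grow grow ⟩
    size (w ∙ x) * size (w ∙ x) ∎
    where
    open ≤-Reasoning
    X = size x
    grow : suc X ≤ size (w ∙ x)
    grow = s≤s (m≤n+m X (size w))

-- Running time of the decision program

module _ (φ ψ : Formula Input) where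

  open Runs {code φ} {code ψ}

  private
    time : ℕ → ℕ
    time N = 22 + size (code φ) + size (code ψ) + 6 * N + cost φ (3 * (3 * (N * N))) + cost ψ (3 * (3 * (N * N)))

    time-polynomial : Polynomial time
    time-polynomial =
      +-polynomial (+-polynomial (+-polynomial (const-polynomial (22 + size (code φ) + size (code ψ)))
        (*-polynomial (const-polynomial 6) id-polynomial))
        (square-polynomial (scale-polynomial (scale-polynomial (cost-polynomial φ)))))
        (square-polynomial (scale-polynomial (scale-polynomial (cost-polynomial ψ))))

    module _ (H : Hypergraph) where
      V = encodeList (List.replicate (order H) nil)
      E = encodeList (List.map encodeSubset (edges H))
      N = size (encodeHypergraph H)
      -- The list of suffixes may be quadratic in the input. The factor 9 makes the bound on the
      -- environment hold coefficient by coefficient, and its form suits two uses of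
      -- `scale-polynomial`.
      M = 3 * (3 * (N * N))
      v = size V
      e = size E

      suffixes-V : suffixes V ≡ encodeSort (list vertex) (vertices (order H))
      suffixes-V = trans (cong suffixes (numeral-replicate (order H))) (suffixes-numeral (order H))

      envSize : size (encodeEnv (input H)) ≤ M
      envSize = begin
        suc (size (encodeSort (list vertex) (vertices (order H))) + suc (e + 3))
                                              ≡⟨ cong (λ x → suc (size x + suc (e + 3))) suffixes-V ⟨
        suc (size (suffixes V) + suc (e + 3)) ≤⟨ s≤s (+-monoˡ-≤ _ (suffixes-size V)) ⟩
        suc (v * v + suc (e + 3))             ≤⟨ slack _ (regroup v e) ⟩
        3 * (3 * (suc (v + e) * suc (v + e)))       ∎
        where
        open ≤-Reasoning
        regroup : ∀ v e → suc (v * v + suc (e + 3))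
                  + (4 + 9 * (e * e) + 8 * (v * v) + 18 * v + 17 * e + 18 * (v * e)) ≡ 3 * (3 * (suc (v + e) * suc (v + e)))
        regroup = solve-∀

      A B : ℕ
      A = suc (size (code φ) + 1 + cost φ M)
      B = suc (size (code ψ) + 1 + cost ψ M)

      ⇓branch : ∀ {x y ρ} →
        (code φ ∷ encodeEnv (input H) ∷ []) ⊢ bodies evalᶠ ⇓ encodeBool x within cost φ M →
        (code ψ ∷ encodeEnv (input H) ∷ []) ⊢ bodies evalᶠ ⇓ encodeBool y within cost ψ M →
        (encodeEnv (input H) ∷ V ∷ E ∷ ρ ∷ []) ⊢
          caseOf (call evalᶠ (constant (code φ) ∷ var (# 0) ∷ [])) nil
            (caseOf (call evalᶠ (constant (code ψ) ∷ var (# 2) ∷ []))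
              (constant (encodeOutcome 𝒮ℒ)) (constant (encodeOutcome ℰ)))
          ⇓ encodeOutcome (outcomeOf x y) within suc (A + suc (B + 5))
      ⇓branch {false} r t = weaken (s≤s (+-monoʳ-≤ A (s≤s z≤n)))
        (⇓caseNil (⇓call (⇓constant (code φ) ⇓∷ ⇓var _ ⇓∷ ⇓[]) r) ⇓nil)
      ⇓branch {true} {false} r t = weaken (s≤s (+-monoʳ-≤ A (s≤s (+-monoʳ-≤ B (m≤n+m 3 2)))))
        (⇓caseCons (⇓call (⇓constant (code φ) ⇓∷ ⇓var _ ⇓∷ ⇓[]) r)
          (⇓caseNil (⇓call (⇓constant (code ψ) ⇓∷ ⇓var _ ⇓∷ ⇓[]) t) (⇓constant (encodeOutcome 𝒮ℒ))))
      ⇓branch {true} {true} r t =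
        (⇓caseCons (⇓call (⇓constant (code φ) ⇓∷ ⇓var _ ⇓∷ ⇓[]) r)
          (⇓caseCons (⇓call (⇓constant (code ψ) ⇓∷ ⇓var _ ⇓∷ ⇓[]) t) (⇓constant (encodeOutcome ℰ))))

      ⇓main : (encodeHypergraph H ∷ []) ⊢ Program.main (decisionProgram (code φ) (code ψ)) ⇓
             encodeOutcome (outcomeOf (does (⟦ φ ⟧? (input H))) (does (⟦ ψ ⟧? (input H)))) within time N
      ⇓main = weaken {A = suc (1 + suc (suc (suc (1 + 6 * v) + 5) + suc (A + suc (B + 5))))} bound
        (⇓caseCons (⇓var _) (⇓letIn
        (recast (cong (_∙ (E ∙ nil ∙ nil)) suffixes-V)
          (⇓cons (⇓call (⇓var _ ⇓∷ ⇓[]) (⇓suffixes V)) (⇓cons (⇓var _) ⇓true)))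
        (⇓branch (⇓eval φ (input H) M envSize) (⇓eval ψ (input H) M envSize))))
        where
        regroup : ∀ v e a b c d →
          suc (1 + suc (suc (suc (1 + 6 * v) + 5) + suc (suc (a + 1 + c) + suc (suc (b + 1 + d) + 5)))) + (6 * e + 6)
          ≡ 22 + a + b + 6 * suc (v + e) + c + d
        regroup = solve-∀
        bound : suc (1 + suc (suc (suc (1 + 6 * v) + 5) + suc (A + suc (B + 5)))) ≤ time N
        bound = slack (6 * e + 6) (regroup v e (size (code φ)) (size (code ψ)) (cost φ M) (cost ψ M))

  decision-polyTime : ∃[ c ] ∃[ d ] ∀ H → ∃[ t ]
    RunsTo (decisionProgram (code φ) (code ψ)) (encodeHypergraph H)
      (encodeOutcome (outcomeOf (does (⟦ φ ⟧? (input H))) (does (⟦ ψ ⟧? (input H))))) t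
    × t ≤ c * size (encodeHypergraph H) ^ d + c
  decision-polyTime = c , d , λ H → let t , run , t≤T = ⇓main H in
    t , run , ≤-trans t≤T (bounded (size (encodeHypergraph H)) (s≤s z≤n))
    where
    bounds = polynomial-bound time-polynomial
    c = proj₁ bounds
    d = proj₁ (proj₂ bounds)
    bounded = proj₂ (proj₂ bounds)

-- The two criteria as formulas

record Globals (Γ : Context) : Set where
  field
    V : list vertex ∈ Γ
    E : list edge ∈ Γ
    ∅ : list vertex ∈ Γ

open Globals

infix 9 _↑
_↑ : ∀ {Γ s} → Globals Γ → Globals (s ∷ Γ)
σ ↑ = record { V = there (V σ) ; E = there (E σ) ; ∅ = there (∅ σ) }

v₀ : ∀ {Γ : Context} {s} → s ∈ s ∷ Γ
v₀ = here refl

∃∖ᶠ : ∀ {Γ} → list vertex ∈ Γ → list vertex ∈ Γ → Formula (vertex ∷ Γ) → Formula Γ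
∃∖ᶠ S T φ = ∃ᶠ S (¬ᶠ ∃ᶠ (there T) (there v₀ ≡ᶠ v₀) ∧ᶠ φ)

module _ {Γ : Context} (σ : Globals Γ) where

  adjacentᶠ : vertex ∈ Γ → vertex ∈ Γ → Formula Γ
  adjacentᶠ x y = ∃ᶠ (E σ) (there x ∈ᶠ v₀ ∧ᶠ there y ∈ᶠ v₀ ∧ᶠ
    ¬ᶠ ∃ᶠ (there (V σ)) (v₀ ∈ᶠ there v₀ ∧ᶠ ¬ᶠ (v₀ ≡ᶠ there (there x)) ∧ᶠ ¬ᶠ (v₀ ≡ᶠ there (there y))))

  emptyᶠ : Formula Γ
  emptyᶠ = ∃ᶠ (E σ) (¬ᶠ ∃ᶠ (there (V σ)) (v₀ ∈ᶠ there v₀))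

-- The criteria concern the start of the game, where only singleton edges spoil vertices; hence the
-- self-adjacency. The list `T` holds the deleted vertices: none for the last player's criterion,
-- one for robustness.
defectᶠ : ∀ {Γ} → Globals Γ → list vertex ∈ Γ → list vertex ∈ Γ → Formula Γ
defectᶠ σ S T =
  ∃∖ᶠ S T (adjacentᶠ (σ ↑) v₀ v₀) ∨ᶠ
  ∃∖ᶠ S T (∃∖ᶠ (there S) (there T) (∃∖ᶠ (there (there S)) (there (there T))
    (¬ᶠ (x ≡ᶠ y) ∧ᶠ ¬ᶠ (y ≡ᶠ z) ∧ᶠ ¬ᶠ (x ≡ᶠ z) ∧ᶠ adjacentᶠ (σ ↑ ↑ ↑) x y ∧ᶠ adjacentᶠ (σ ↑ ↑ ↑) y z)))
  where
  x = there (there v₀)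
  y = there v₀
  z = v₀

-- The conjuncts are nonemptiness, coveredness and robustness. Evenness and absence of repetitions
-- come from the search, which adds two new vertices at a time.
badᶠ : ∀ {Γ} → Globals Γ → list vertex ∈ Γ → Formula Γ
badᶠ σ S =
  ∃ᶠ S (v₀ ≡ᶠ v₀) ∧ᶠ
  ¬ᶠ ∃ᶠ S (¬ᶠ (adjacentᶠ (σ ↑) v₀ v₀ ∨ᶠ
              ∃ᶠ (there S) (¬ᶠ (there v₀ ≡ᶠ v₀) ∧ᶠ adjacentᶠ (σ ↑ ↑) (there v₀) v₀))) ∧ᶠ
  ¬ᶠ ∃ᶠ S (¬ᶠ push v₀ (there (∅ σ)) (defectᶠ (σ ↑ ↑) (there (there S)) v₀))

-- Vertices are added in pairs because bad sets are even.
searchᶠ : ∀ {Γ} → ℕ → Globals Γ → list vertex ∈ Γ → Formula Γ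
searchᶠ zero    σ S = badᶠ σ S
searchᶠ (suc k) σ S = badᶠ σ S ∨ᶠ
  ∃∖ᶠ (V σ) S (push v₀ (there S) (∃∖ᶠ (V (σ ↑ ↑)) v₀ (push v₀ (there v₀)
    (searchᶠ k (σ ↑ ↑ ↑ ↑) v₀))))

globals : Globals Input
globals = record { V = here refl ; E = there (here refl) ; ∅ = there (there (here refl)) }

lastLossᶠ : Formula Input
lastLossᶠ = emptyᶠ globals ∨ᶠ defectᶠ globals (V globals) (∅ globals)

secondToLastLossᶠ : Formula Input
-- Six pairs make up the 12 vertices allowed by `small-bad`.
secondToLastLossᶠ = emptyᶠ globals ∨ᶠ searchᶠ 6 globals (∅ globals)

-- Correctness of the two criteria

module Semantics (H : Hypergraph) where

  open Play H
  open Adjacency adjacent? adjacent-sym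

  Self : Fin n → Set
  Self x = Adjacent x x

  record Meaning {Γ} (σ : Globals Γ) (ρ : Env n Γ) : Set where
    field
      V-all   : ∀ v → v ∈ fetch ρ (V σ)
      E-edges : fetch ρ (E σ) ≡ edges H
      ∅-empty : fetch ρ (∅ σ) ≡ []

  open Meaning

  infixl 5 _▹_
  _▹_ : ∀ {Γ s} {σ : Globals Γ} {ρ} → Meaning σ ρ → (x : ⟦_⟧ˢ n s) → Meaning (σ ↑) (x ∷ ρ)
  μ ▹ _ = record { V-all = V-all μ ; E-edges = E-edges μ ; ∅-empty = ∅-empty μ }

  module _ {Γ} {σ : Globals Γ} {ρ : Env n Γ} (μ : Meaning σ ρ) where

    module _ (x y : vertex ∈ Γ) where

      adjacent⁻ : ⟦ adjacentᶠ σ x y ⟧ ρ → Adjacent (fetch ρ x) (fetch ρ y)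
      adjacent⁻ = Any.map (λ (x∈e , y∈e , only) → x∈e , y∈e , λ z z∈e →
          decidable-stable (z Fin.≟ _ ⊎-dec z Fin.≟ _) λ other →
            only (lose (V-all μ z) (z∈e , other ∘ inj₁ , other ∘ inj₂)))
        ∘ subst (Any _) (E-edges μ)

      adjacent⁺ : Adjacent (fetch ρ x) (fetch ρ y) → ⟦ adjacentᶠ σ x y ⟧ ρ
      adjacent⁺ = subst (Any _) (sym (E-edges μ)) ∘ Any.map (λ (x∈e , y∈e , only) → x∈e , y∈e , λ third →
        let z , _ , z∈e , z≢x , z≢y = find third in [ z≢x , z≢y ]′ (only z z∈e))

    empty⁻ : ⟦ emptyᶠ σ ⟧ ρ → HasWon H enforcer (start H)
    empty⁻ = Any.map (λ empty v v∈e → ⊥-elim (empty (lose (V-all μ v) v∈e))) ∘ subst (Any _) (E-edges μ)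

    empty⁺ : HasWon H enforcer (start H) → ⟦ emptyᶠ σ ⟧ ρ
    empty⁺ = subst (Any _) (sym (E-edges μ)) ∘ Any.map λ full some → let v , _ , v∈e = find some in
      case trans (sym (lookup-replicate v nothing)) (full v v∈e) of λ ()

  module _ {S T : Finset n} {P : Fin n → Set} where

    ∃∖⁻ : Any (λ x → x ∉ T × P x) S → ∃[ x ] x ∈ S ∖ T × P x
    ∃∖⁻ some = let x , x∈S , x∉T , Px = find some in x , ∈-∖⁺ x∈S x∉T , Px

    ∃∖⁺ : ∀ {x} → x ∈ S ∖ T → P x → Any (λ x → x ∉ T × P x) S
    ∃∖⁺ x∈ Px = let x∈S , x∉T = ∈-∖⁻ {S = S} x∈ in lose x∈S (x∉T , Px)

  module _ {Γ} {σ : Globals Γ} {ρ : Env n Γ} (μ : Meaning σ ρ) (S T : list vertex ∈ Γ) where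

    defect⁻ : ⟦ defectᶠ σ S T ⟧ ρ → Defect Self (fetch ρ S ∖ fetch ρ T)
    defect⁻ (inj₁ some) = let x , x∈ , adj = ∃∖⁻ some in loop x∈ (adjacent⁻ (μ ▹ x) v₀ v₀ adj)
    defect⁻ (inj₂ some) =
      let x , x∈ , some-y = ∃∖⁻ some
          y , y∈ , some-z = ∃∖⁻ some-y
          z , z∈ , x≢y , y≢z , x≢z , xy , yz = ∃∖⁻ some-z
      in path x∈ y∈ z∈ x≢y y≢z x≢z (adjacent⁻ (μ ▹ x ▹ y ▹ z) (there (there v₀)) (there v₀) xy)
                                   (adjacent⁻ (μ ▹ x ▹ y ▹ z) (there v₀) v₀ yz)

    defect⁺ : Defect Self (fetch ρ S ∖ fetch ρ T) → ⟦ defectᶠ σ S T ⟧ ρ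
    defect⁺ (loop {x} x∈ adj) = inj₁ (∃∖⁺ x∈ (adjacent⁺ (μ ▹ x) v₀ v₀ adj))
    defect⁺ (path {x} {y} {z} x∈ y∈ z∈ x≢y y≢z x≢z xy yz) = inj₂
      (∃∖⁺ x∈ (∃∖⁺ y∈ (∃∖⁺ z∈
        (x≢y , y≢z , x≢z , adjacent⁺ (μ ▹ x ▹ y ▹ z) (there (there v₀)) (there v₀) xy
                         , adjacent⁺ (μ ▹ x ▹ y ▹ z) (there v₀) v₀ yz))))

  module _ {Γ} {σ : Globals Γ} {ρ : Env n Γ} (μ : Meaning σ ρ) (S : list vertex ∈ Γ) where

    bad⁻ : Unique (fetch ρ S) → parity (length (fetch ρ S)) ≡ 0ℙ → ⟦ badᶠ σ S ⟧ ρ → Bad Self (fetch ρ S)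
    bad⁻ unique even (some , covered , robust) = record
      { unique   = unique
      ; even     = even
      ; nonempty = let x , x∈S , _ = find some in x , x∈S
      ; covered  = λ {x} x∈S → case decidable-stable (⟦ cover ⟧? (x ∷ ρ)) (λ no → covered (lose x∈S no)) of λ where
          (inj₁ adj)  → inj₁ (adjacent⁻ (μ ▹ x) v₀ v₀ adj)
          (inj₂ some) → let y , y∈S , x≢y , adj = find some in
            inj₂ (y , y∈S , x≢y , adjacent⁻ (μ ▹ x ▹ y) (there v₀) v₀ adj)
      ; robust   = λ {u} u∈S → subst (λ T → Defect Self (fetch ρ S ∖ (u ∷ T))) (∅-empty μ)
          (defect⁻ (μ ▹ u ▹ (u ∷ fetch ρ (∅ σ))) (there (there S)) v₀
            (decidable-stable (⟦ rest ⟧? (u ∷ ρ)) (λ no → robust (lose u∈S no))))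
      }
      where
      cover rest : Formula (vertex ∷ Γ)
      cover = adjacentᶠ (σ ↑) v₀ v₀ ∨ᶠ ∃ᶠ (there S) (¬ᶠ (there v₀ ≡ᶠ v₀) ∧ᶠ adjacentᶠ (σ ↑ ↑) (there v₀) v₀)
      rest = push v₀ (there (∅ σ)) (defectᶠ (σ ↑ ↑) (there (there S)) v₀)

    bad⁺ : Bad Self (fetch ρ S) → ⟦ badᶠ σ S ⟧ ρ
    bad⁺ bad = lose (proj₂ nonempty) refl
      , (λ some → let x , x∈S , uncovered = find some in uncovered (case covered x∈S of λ where
            (inj₁ adj)                   → inj₁ (adjacent⁺ (μ ▹ x) v₀ v₀ adj)
            (inj₂ (y , y∈S , x≢y , adj)) → inj₂ (lose y∈S (x≢y , adjacent⁺ (μ ▹ x ▹ y) (there v₀) v₀ adj))))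
      , (λ some → let u , u∈S , fragile = find some in fragile
            (defect⁺ (μ ▹ u ▹ (u ∷ fetch ρ (∅ σ))) (there (there S)) v₀
              (subst (λ T → Defect Self (fetch ρ S ∖ (u ∷ T))) (sym (∅-empty μ)) (robust u∈S))))
      where open Bad bad

  search⁻ : ∀ k {Γ} {σ : Globals Γ} {ρ : Env n Γ} (μ : Meaning σ ρ) (S : list vertex ∈ Γ) →
            Unique (fetch ρ S) → parity (length (fetch ρ S)) ≡ 0ℙ → ⟦ searchᶠ k σ S ⟧ ρ → ∃[ T ] Bad Self T
  search⁻ zero    μ S unique even bad        = _ , bad⁻ μ S unique even bad
  search⁻ (suc k) μ S unique even (inj₁ bad) = _ , bad⁻ μ S unique even bad
  search⁻ (suc k) {σ = σ} {ρ} μ S unique even (inj₂ some) =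
    let x , x∈ , some-y = ∃∖⁻ some
        y , y∈ , found = ∃∖⁻ some-y
    in search⁻ k (μ ▹ x ▹ (x ∷ fetch ρ S) ▹ y ▹ (y ∷ x ∷ fetch ρ S)) v₀
         (∉-unique (proj₂ (∈-∖⁻ {S = fetch ρ (V σ)} y∈))
           (∉-unique (proj₂ (∈-∖⁻ {S = fetch ρ (V σ)} x∈)) unique)) even found

  unique-ʳ++ : ∀ (R : Finset n) {S} → Unique (R ʳ++ S) → Unique S
  unique-ʳ++ []      u = u
  unique-ʳ++ (x ∷ R) u = AllPairs.tail (unique-ʳ++ R u)

  -- The search pushes onto the front of its list. `R` holds the vertices still to come, in the
  -- order of pushing, so `R ʳ++ fetch ρ S` is the final list throughout.
  search⁺ : ∀ k R {Γ} {σ : Globals Γ} {ρ : Env n Γ} (μ : Meaning σ ρ) (S : list vertex ∈ Γ) →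
            length R ≤ k * 2 → parity (length R) ≡ 0ℙ → Bad Self (R ʳ++ fetch ρ S) → ⟦ searchᶠ k σ S ⟧ ρ
  search⁺ zero    []          μ S _ _ bad = bad⁺ μ S bad
  search⁺ (suc k) []          μ S _ _ bad = inj₁ (bad⁺ μ S bad)
  search⁺ (suc k) (x ∷ y ∷ R) {σ = σ} {ρ} μ S (s≤s (s≤s R≤)) even bad = inj₂
    (∃∖⁺ (∈-∖⁺ (V-all μ x) (unique-∉ (unique-ʳ++ (y ∷ R) u)))
      (∃∖⁺ (∈-∖⁺ (V-all μ y) (unique-∉ (unique-ʳ++ R u)))
        (search⁺ k R (μ ▹ x ▹ (x ∷ fetch ρ S) ▹ y ▹ (y ∷ x ∷ fetch ρ S)) v₀ R≤ even bad)))
    where u = Bad.unique bad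

  meaning : Meaning globals (input H)
  meaning = record { V-all = vertices-complete ; E-edges = refl ; ∅-empty = refl }

  spoiled-start⁻ : ∀ {x} → Spoiled (start H) x → Self x
  spoiled-start⁻ (v , adj , inj₁ refl) = adj
  spoiled-start⁻ (v , adj , inj₂ a)    = case trans (sym (lookup-replicate v nothing)) a of λ ()

  spoiled-start⁺ : ∀ {x} → Self x → Spoiled (start H) x
  spoiled-start⁺ adj = _ , adj , inj₁ refl

  start-free : ∀ {v} → v ∈ unpicked (start H)
  start-free {v} = ∈-unpicked⁺ (lookup-replicate v nothing)

  start-size : length (unpicked (start H)) ≡ n
  start-size = trans
    (unique-length-≡ (unpicked-unique (start H)) (Unique.allFin⁺ n) (λ _ → ∈-allFin _) (λ _ → start-free))
    (length-tabulate id)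

  -- Avoider makes the last move precisely when an odd number of vertices is left at each of her
  -- turns.
  parityAt-avoider-last : parity n ≡ parityAt 1ℙ (firstIfLast H avoider)
  parityAt-avoider-last with parity n
  ... | 1ℙ = refl
  ... | 0ℙ = refl

  parityAt-enforcer-last : parity n ≡ parityAt 0ℙ (firstIfLast H enforcer)
  parityAt-enforcer-last with parity n
  ... | 1ℙ = refl
  ... | 0ℙ = refl

  enforcer-second : ⟦ lastLossᶠ ⟧ (input H) → WinsAsSecondToLast H enforcer
  enforcer-second (inj₁ empty) = won-persists n _ start-size (empty⁻ meaning empty)
  enforcer-second (inj₂ some) =
    EnforcerWins.strategy Trap 1ℙ Trap.unique Trap.odd (λ t → inhabited (Trap.odd t)) (λ f → trap-map f)
      (λ f v∈S ¬Lv g → trap-shrinks f v∈S ¬Lv g)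
      n _ start-size parityAt-avoider-last (λ _ → start-free) (trap-map spoiled-start⁺ trap)
    where
    inhabited : ∀ {S : Finset n} → parity (length S) ≡ 1ℙ → ∃[ x ] x ∈ S
    inhabited {x ∷ S} _ = x , here refl
    trap : Trap Self _
    trap = let S , c = core (defect⁻ meaning (V globals) (∅ globals) some) in
      record { unique = Core.unique c ; odd = Core.odd c ; covered = Core.covered c }

  enforcer-last : ⟦ secondToLastLossᶠ ⟧ (input H) → WinsAsLast H enforcer
  enforcer-last (inj₁ empty) = won-persists n _ start-size (empty⁻ meaning empty)
  enforcer-last (inj₂ found) =
    EnforcerWins.strategy Bad 0ℙ Bad.unique Bad.even Bad.nonempty (λ f → bad-map (λ _ → f))
      (λ f v∈S ¬Lv g → bad-shrinks f v∈S ¬Lv g)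
      n _ start-size parityAt-enforcer-last (λ _ → start-free)
      (bad-map (λ _ → spoiled-start⁺) (proj₂ (search⁻ 6 meaning (∅ globals) [] refl found)))

  sparse-start : ¬ ⟦ secondToLastLossᶠ ⟧ (input H) → Sparse Self (unpicked (start H))
  sparse-start ¬loss {S} _ short bad = ¬loss (inj₂ (search⁺ 6 (reverse S) meaning (∅ globals)
    (≤-trans (≤-reflexive (length-reverse S)) short)
    (trans (cong parity (length-reverse S)) (Bad.even bad))
    (subst (Bad Self) (sym (reverse-involutive S)) bad)))

  -- A bad set contains a defect even after a deletion. This excludes a fourth outcome, in which
  -- whichever player is last wins.
  last⇒ : ⟦ secondToLastLossᶠ ⟧ (input H) → ⟦ lastLossᶠ ⟧ (input H)
  last⇒ (inj₁ empty) = inj₁ empty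
  last⇒ (inj₂ found) = let S , bad = search⁻ 6 meaning (∅ globals) [] refl found in
    inj₂ (defect⁺ meaning (V globals) (∅ globals)
      (defect-mono (λ _ → ∈-∖⁺ (vertices-complete _) λ ()) (Bad.robust bad (proj₂ (Bad.nonempty bad)))))

  module _ (rank2 : HasRank2 H) where

    avoider-last : ¬ ⟦ lastLossᶠ ⟧ (input H) → WinsAsLast H avoider
    avoider-last ¬loss = AvoiderWins.strategy rank2 (λ L V → ¬ Defect L V) 1ℙ
      (λ W⊆V f ¬defect → ¬defect ∘ defect-map W⊆V f) (λ L? unique odd _ → defect-free-move L? unique odd)
      n _ start-size parityAt-avoider-last (¬loss ∘ inj₁ ∘ empty⁺ meaning)
      (λ defect → ¬loss (inj₂ (defect⁺ meaning (V globals) (∅ globals)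
        (defect-map (λ _ → ∈-∖⁺ (vertices-complete _) λ ()) (λ _ → spoiled-start⁻) defect))))

    avoider-second : ¬ ⟦ secondToLastLossᶠ ⟧ (input H) → WinsAsSecondToLast H avoider
    avoider-second ¬loss = AvoiderWins.strategy rank2 Sparse 0ℙ
      sparse-anti (λ L? unique → sparse-move L? unique)
      n _ start-size parityAt-enforcer-last (¬loss ∘ inj₁ ∘ empty⁺ meaning)
      (sparse-anti id (λ _ → spoiled-start⁻) (sparse-start ¬loss))

    outcome-correct : (last? : Dec (⟦ lastLossᶠ ⟧ (input H))) (second? : Dec (⟦ secondToLastLossᶠ ⟧ (input H))) →
                      HasOutcome H (outcomeOf (does last?) (does second?))
    outcome-correct (no ¬last)  _             = avoider-last ¬last , avoider-second (¬last ∘ last⇒)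
    outcome-correct (yes last)  (no ¬second)  = avoider-second ¬second , enforcer-second last
    outcome-correct (yes last)  (yes second)  = enforcer-last second , enforcer-second last

corollary3p3 : PolyTimeComputable encodeHypergraph encodeOutcome HasRank2 HasOutcome
corollary3p3 = decisionProgram (code lastLossᶠ) (code secondToLastLossᶠ)
  , proj₁ bounds , proj₁ (proj₂ bounds) , λ H rank2 →
  let t , run , t≤ = proj₂ (proj₂ bounds) H in
  outcomeOf (does (⟦ lastLossᶠ ⟧? (input H))) (does (⟦ secondToLastLossᶠ ⟧? (input H))) , t
  , Semantics.outcome-correct H rank2 (⟦ lastLossᶠ ⟧? (input H)) (⟦ secondToLastLossᶠ ⟧? (input H)) , run , t≤
  where bounds = decision-polyTime lastLossᶠ secondToLastLossᶠ
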